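{- Let $G=(V,E)$ be a simple, finite, connected reflective graph. Then $G$ is a cartesian product of (one or more) graphs from the following list: cocktail party graphs $CP(k)$, Hamming graphs $K_n^m$, Johnson graphs $J(n,k)$, halved cubes $Q^{(2)}(n)$, the Schläfli graph, the Gosset graph.
   Context: $d$ is the graph distance. For adjacent $x\sim y$ let $V_x^y=\{x': d(x',x)<d(x',y)\}$, $V^{xy}=\{z: d(z,x)=d(z,y)\}$. A reflection from $x$ to $y$ is a map $\phi:V\to V$ which is a graph automorphism with $\phi^2=\mathrm{id}$, $\phi(x)=y$, such that the set of edges between $V_x^y$ and $V_y^x$ is exactly $\{(x',\phi(x')):x'\in V_x^y\}$, and $\phi(z)=z$ for all $z\in V^{xy}$. $G$ is reflective if a reflection from $x$ to $y$ exists for every edge $x\sim y$. The Hamming graph $K_n^m$ is the cartesian product of $m$ copies of the complete graph $K_n$. -}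

module Defs where

open import Data.Nat using (ℕ; zero; suc; _+_; _≤_; _<_; _%_)
open import Data.Fin using (Fin)
open import Data.Fin.Subset using (Subset; _∩_; ∣_∣)
open import Data.Bool using (Bool; true; false)
open import Data.Vec using (Vec; []; _∷_)
open import Data.Product using (Σ; ∃; ∃-syntax; _×_; _,_; proj₁)
open import Data.Sum using (_⊎_)
open import Data.Unit using (⊤)
open import Data.Empty using (⊥)
open import Data.List using (List; []; _∷_)
open import Data.List.NonEmpty using (List⁺; _∷_)
open import Relation.Nullary using (¬_; Dec)
open import Relation.Binary.PropositionalEquality using (_≡_; _≢_)
open import Function.Bundles using (_↔_; _⇔_)

record Graph : Set₁ where
  field
    V : Set
    E : V → V → Set
open Graph public

-- simple: adjacency symmetric and irreflexive (no loops, no multi-edges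
-- since E is a relation)
record IsSimple (G : Graph) : Set where
  field
    sym   : ∀ {a b} → E G a b → E G b a
    irrefl : ∀ a → ¬ E G a a

record IsFinite (G : Graph) : Set where
  field
    size : ℕ
    enum : V G ↔ Fin size
    adj? : ∀ a b → Dec (E G a b)

data Walk (G : Graph) : V G → V G → ℕ → Set where
  here : ∀ {a} → Walk G a a 0
  step : ∀ {a b c n} → E G a b → Walk G b c n → Walk G a c (suc n)

Connected : Graph → Set
Connected G = V G × (∀ a b → ∃[ k ] Walk G a b k)

Dist : (G : Graph) → V G → V G → ℕ → Set
Dist G a b k = Walk G a b k × (∀ l → Walk G a b l → k ≤ l)

InV : (G : Graph) → V G → V G → V G → Set
InV G x y a = ∃[ k ] ∃[ l ] (Dist G a x k × Dist G a y l × k < l)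

InVeq : (G : Graph) → V G → V G → V G → Set
InVeq G x y z = ∃[ k ] (Dist G z x k × Dist G z y k)

record Reflection (G : Graph) (x y : V G) : Set where
  field
    φ        : V G → V G
    auto     : ∀ a b → E G a b ⇔ E G (φ a) (φ b)
    invol    : ∀ a → φ (φ a) ≡ a
    φx≡y     : φ x ≡ y
    cross    : ∀ a → InV G x y a → InV G y x (φ a) × E G a (φ a)
    onlyEdge : ∀ a b → InV G x y a → InV G y x b → E G a b → b ≡ φ a
    fixes    : ∀ z → InVeq G x y z → φ z ≡ z

Reflective : Graph → Set
Reflective G = ∀ x y → E G x y → Reflection G x y

record _≅_ (G H : Graph) : Set where
  field
    bij : V G ↔ V H
  open Function.Bundles.Inverse bij public using (to)
  field
    pres : ∀ a b → E G a b ⇔ E H (to a) (to b)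

_□_ : Graph → Graph → Graph
G □ H = record
  { V = V G × V H
  ; E = λ { (a , b) (a' , b') → (E G a a' × b ≡ b') ⊎ (a ≡ a' × E H b b') } }

prodL : Graph → List Graph → Graph
prodL g []       = g
prodL g (h ∷ hs) = g □ prodL h hs

⨂ : List⁺ Graph → Graph
⨂ (g ∷ gs) = prodL g gs

K₁ : Graph
K₁ = record { V = ⊤ ; E = λ _ _ → ⊥ }

Complete : ℕ → Graph
Complete n = record { V = Fin n ; E = λ i j → i ≢ j }

power : Graph → ℕ → Graph
power G zero    = K₁
power G (suc m) = G □ power G m

Hamming : ℕ → ℕ → Graph
Hamming n m = power (Complete n) m

CocktailParty : ℕ → Graph
CocktailParty k = record { V = Fin k × Bool ; E = λ p q → proj₁ p ≢ proj₁ q }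

Johnson : ℕ → ℕ → Graph
Johnson n k = record
  { V = Σ (Subset n) (λ s → ∣ s ∣ ≡ k)
  ; E = λ s t → suc ∣ proj₁ s ∩ proj₁ t ∣ ≡ k }

hdist : ∀ {n} → Vec Bool n → Vec Bool n → ℕ
hdist []          []          = 0
hdist (false ∷ u) (false ∷ v) = hdist u v
hdist (true ∷ u)  (true ∷ v)  = hdist u v
hdist (false ∷ u) (true ∷ v)  = suc (hdist u v)
hdist (true ∷ u)  (false ∷ v) = suc (hdist u v)

HalvedCube : ℕ → Graph
HalvedCube n = record
  { V = Σ (Subset n) (λ s → ∣ s ∣ % 2 ≡ 0)
  ; E = λ s t → hdist (proj₁ s) (proj₁ t) ≡ 2 }

-- Schläfli graph: the 27 lines a_i, b_i, c_ij (i<j) of a cubic surface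
-- (Schläfli double-six notation), adjacent iff skew.
data Line : Set where
  a : Fin 6 → Line
  b : Fin 6 → Line
  c : (i j : Fin 6) → Data.Fin._<_ i j → Line

common : Fin 6 → Fin 6 → Fin 6 → Fin 6 → ℕ
common i j k l = ind i k + ind i l + ind j k + ind j l
  where
  ind : Fin 6 → Fin 6 → ℕ
  ind p q with p Data.Fin.≟ q
  ... | Relation.Nullary.yes _ = 1
  ... | Relation.Nullary.no _  = 0

Skew : Line → Line → Set
Skew (a i)     (a j)     = i ≢ j
Skew (a i)     (b j)     = i ≡ j
Skew (a i)     (c j k _) = i ≢ j × i ≢ k
Skew (b i)     (a j)     = i ≡ j
Skew (b i)     (b j)     = i ≢ j
Skew (b i)     (c j k _) = i ≢ j × i ≢ k
Skew (c j k _) (a i)     = i ≢ j × i ≢ k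
Skew (c j k _) (b i)     = i ≢ j × i ≢ k
Skew (c i j _) (c k l _) = common i j k l ≡ 1

Schlafli : Graph
Schlafli = record { V = Line ; E = Skew }

-- Gosset graph: two copies of the 28 edges of K_8 (2-subsets of Fin 8);
-- same copy: adjacent iff the edges share exactly one vertex;
-- different copies: adjacent iff the edges are disjoint.
-- (Equivalently: vectors ±(3,3,-1,...,-1) up to permutation in ℝ^8,
--  adjacent iff inner product 8.)
Gosset : Graph
Gosset = record
  { V = Σ (Subset 8) (λ s → ∣ s ∣ ≡ 2) × Bool
  ; E = λ { ((s , _) , σ) ((t , _) , τ) →
            (σ ≡ τ × ∣ s ∩ t ∣ ≡ 1) ⊎ (σ ≢ τ × ∣ s ∩ t ∣ ≡ 0) } }

data Factor : Set where
  cocktailParty : (k : ℕ) → Factor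
  hamming       : (n m : ℕ) → Factor
  johnson       : (n k : ℕ) → Factor
  halvedCube    : (n : ℕ) → Factor
  schlafli      : Factor
  gosset        : Factor

⟦_⟧ : Factor → Graph
⟦ cocktailParty k ⟧ = CocktailParty k
⟦ hamming n m ⟧     = Hamming n m
⟦ johnson n k ⟧     = Johnson n k
⟦ halvedCube n ⟧    = HalvedCube n
⟦ schlafli ⟧        = Schlafli
⟦ gosset ⟧          = Gosset

{-# OPTIONS --safe #-}

-- In the distance δ of a reflective graph, the reflection in an edge xy takes a
-- vertex u nearer to x to "u − x + y", a vertex u' with
--   δ u' v + δ x v = δ u v + δ y v   for all v.
-- So every vertex is an affine combination, built from such parallelograms, of a
-- chosen vertex and its neighbours, and distances are affine in each argument: a
-- connected graph with this property is determined by one local graph. In a local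
-- graph, where δ ≤ 2, a path of length three can be shortened, so its components
-- have diameter at most two and inherit the parallelograms. By induction on the
-- number of vertices, each component is K_m × K_n, CP(k), J(n,2), the halved
-- 5-cube or the Schläfli graph. These are the local graphs of J(m+n,m), CP(k+1),
-- the halved n-cube, the Schläfli graph and the Gosset graph, and the local graph
-- of a product is the disjoint union of those of the factors; hence the whole
-- graph is the product of the graphs belonging to the components. The induction
-- closes since few of these products have diameter at most two.

module Submission where

open import Defs hiding (a; b; c)
import Defs
open import Axiom.UniquenessOfIdentityProofs.WithK using (uip)
open import Data.Bool using (Bool; true; false; not; if_then_else_)
import Data.Bool.Properties as Bool
open import Data.Empty using (⊥; ⊥-elim)
open import Data.Fin using (Fin; zero; suc)
import Data.Fin as Fin
import Data.Fin.Properties as Fin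
open import Data.Fin.Subset using (Subset; _∩_; _∪_; ∣_∣; ∁; ⁅_⁆)
import Data.Fin.Subset as Subset
open import Data.Fin.Subset.Properties using (∪-identityˡ; ∣⁅x⁆∣≡1; ∣⊥∣≡0; ∣⊤∣≡n)
open import Data.List using (List; []; _∷_; length; allFin)
import Data.List as List
open import Data.List.Membership.Propositional using (_∈_; find; lose)
open import Data.List.Membership.Propositional.Properties using (∈-map⁺; ∈-allFin)
open import Data.List.NonEmpty using (List⁺; _∷_; _∷⁺_; map)
open import Data.List.Properties using (length-map; length-tabulate)
open import Data.List.Relation.Unary.Any using (here; there; any?)
open import Data.Nat
open import Data.Nat.Properties
open import Data.Nat.Tactic.RingSolver using (solve-∀)
open import Data.Product using (Σ; ∃; ∃-syntax; _×_; _,_; proj₁; proj₂)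
open import Data.Sum using (_⊎_; inj₁; inj₂; [_,_]′)
open import Data.Unit using (⊤; tt)
open import Data.Vec using (Vec; []; _∷_; _++_; take; drop)
import Data.Vec.Properties as Vec
open import Function.Base using (_∘_; id)
open import Function.Bundles using (_⇔_; mk⇔; mk↔ₛ′; Inverse; Equivalence)
open import Relation.Binary.Definitions using (tri<; tri≈; tri>)
open import Relation.Binary.PropositionalEquality hiding (J)
open import Relation.Nullary
open import Relation.Nullary.Decidable hiding (map)

-- An affine relation between vertices is read as an equation in ℕ between distances, valid at every
-- vertex; this gives `u − x + y` a meaning inside the graph. The class of metrics is chosen so that
-- the induction can run. A local graph may be disconnected and then falls outside the theorem, but
-- the neighbours of `o` form a level set of an affine function, so they inherit the parallelograms
-- together with the distance of the whole graph, which is at most two there. Between components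
-- this distance is two although no common neighbour exists; hence geodesics are a separate
-- condition, regained in each component. A component is rebuilt from its own, smaller, local graph,
-- and the bound on its diameter then limits which products can occur. Since one local graph
-- determines the whole, every comparison is made at a chosen origin. Reflections enter only through
-- the parallelograms: folding the graph along a reflection shows that the image of a vertex is no
-- nearer than the vertex itself to the points on its own side.

-- Linear arithmetic without subtraction: the second hypothesis is a semiring identity.
modulo : ∀ {m n l r} → m ≡ n → l + n ≡ r + m → l ≡ r
modulo {m} refl e = +-cancelʳ-≡ m _ _ e

-- Metrics with parallelograms and their isometries

-- The clause [para] says that u' = u − x + y, where a vertex v stands for the
-- function δ v: the reflection of u in the edge from x to y.
record ParMetric (A : Set) : Set where
  field
    δ      : A → A → ℕ
    δ-refl : ∀ u → δ u u ≡ 0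
    δ-zero : ∀ {u v} → δ u v ≡ 0 → u ≡ v
    δ-sym  : ∀ u v → δ u v ≡ δ v u
    δ-lip  : ∀ {x y} u → δ x y ≡ 1 → δ u y ≤ suc (δ u x)
    para   : ∀ {x y u} → δ x y ≡ 1 → δ u y ≡ suc (δ u x) →
             ∃[ u' ] ∀ v → δ u' v + δ x v ≡ δ u v + δ y v
open ParMetric

-- Kept apart from `ParMetric` because a local metric can lack it: points of different components
-- are at distance two without a common neighbour.
Geodesic : ∀ {A} → ParMetric A → Set
Geodesic M = ∀ u v n → δ M u v ≡ suc n → ∃[ w ] (δ M u w ≡ 1 × δ M w v ≡ n)

infix 4 _≃_
-- One inverse law is a field; the other follows in `from-to`, as an isometry is injective by
-- `δ-zero`.
record _≃_ {A B : Set} (M : ParMetric A) (N : ParMetric B) : Set where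
  field
    to      : A → B
    from    : B → A
    isom    : ∀ u v → δ N (to u) (to v) ≡ δ M u v
    to-from : ∀ u → to (from u) ≡ u

  from-isom : ∀ u v → δ M (from u) (from v) ≡ δ N u v
  from-isom u v = trans (sym (isom _ _)) (cong₂ (δ N) (to-from u) (to-from v))

  from-to : ∀ u → from (to u) ≡ u
  from-to u = δ-zero M (trans (sym (isom _ _))
    (trans (cong (λ v → δ N v (to u)) (to-from (to u))) (δ-refl N (to u))))
open _≃_

≃-refl : ∀ {A} {M : ParMetric A} → M ≃ M
≃-refl = record { to = id ; from = id ; isom = λ _ _ → refl ; to-from = λ _ → refl }

≃-sym : ∀ {A B} {M : ParMetric A} {N : ParMetric B} → M ≃ N → N ≃ M
≃-sym e = record { to = from e ; from = to e ; isom = from-isom e ; to-from = from-to e }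

≃-trans : ∀ {A B C} {M : ParMetric A} {N : ParMetric B} {P : ParMetric C} →
          M ≃ N → N ≃ P → M ≃ P
≃-trans e f = record
  { to      = to f ∘ to e
  ; from    = from e ∘ from f
  ; isom    = λ u v → trans (isom f _ _) (isom e _ _)
  ; to-from = λ u → trans (cong (to f) (to-from e _)) (to-from f u)
  }

-- The distance of a finite connected graph

least : (P : ℕ → Set) → (∀ n → Dec (P n)) → ∀ n → P n → ∃[ m ] (P m × (∀ l → P l → m ≤ l))
least P P? n p with P? 0
least P P? n       p | yes p₀ = 0 , p₀ , λ _ _ → z≤n
least P P? zero    p | no ¬p₀ = ⊥-elim (¬p₀ p)
least P P? (suc n) p | no ¬p₀ with least (P ∘ suc) (P? ∘ suc) n p
... | m , pm , min = suc m , pm , λ { zero q → ⊥-elim (¬p₀ q) ; (suc l) q → s≤s (min l q) }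

module GraphDistance (G : Graph) (simple : IsSimple G) (finite : IsFinite G)
                     (connected : Connected G) where
  open IsSimple simple renaming (sym to E-sym; irrefl to E-irrefl)
  open IsFinite finite

  any-vertex? : (P : V G → Set) → (∀ u → Dec (P u)) → Dec (∃ P)
  any-vertex? P P? = map′ (λ { (i , p) → Inverse.from enum i , p })
    (λ { (u , p) → Inverse.to enum u , subst P (sym (Inverse.strictlyInverseʳ enum u)) p })
    (Fin.any? (λ i → P? (Inverse.from enum i)))

  vertex-≟ : (u v : V G) → Dec (u ≡ v)
  vertex-≟ u v = map′
    (λ e → trans (sym (Inverse.strictlyInverseʳ enum u))
             (trans (cong (Inverse.from enum) e) (Inverse.strictlyInverseʳ enum v)))
    (cong (Inverse.to enum)) (Inverse.to enum u Fin.≟ Inverse.to enum v)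

  walk? : ∀ u v n → Dec (Walk G u v n)
  walk? u v zero    = map′ (λ { refl → here }) (λ { here → refl }) (vertex-≟ u v)
  walk? u v (suc n) = map′ (λ { (_ , e , p) → step e p }) (λ { (step e p) → _ , e , p })
    (any-vertex? _ (λ w → adj? u w ×-dec walk? w v n))

  distance : ∀ u v → ∃ (Dist G u v)
  distance u v = let n , p = proj₂ connected u v in least (Walk G u v) (walk? u v) n p

  d : V G → V G → ℕ
  d u v = proj₁ (distance u v)

  d-Dist : ∀ u v → Dist G u v (d u v)
  d-Dist u v = proj₂ (distance u v)

  d-min : ∀ {u v n} → Walk G u v n → d u v ≤ n
  d-min = proj₂ (d-Dist _ _) _

  d-walk : ∀ u v → Walk G u v (d u v)
  d-walk u v = proj₁ (d-Dist u v)

  snoc : ∀ {u v w n} → Walk G u v n → E G v w → Walk G u w (suc n)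
  snoc here       f = step f here
  snoc (step e p) f = step e (snoc p f)

  reverse : ∀ {u v n} → Walk G u v n → Walk G v u n
  reverse here       = here
  reverse (step e p) = snoc (reverse p) (E-sym e)

  d-refl : ∀ u → d u u ≡ 0
  d-refl u = n≤0⇒n≡0 (d-min here)

  d-zero : ∀ {u v} → d u v ≡ 0 → u ≡ v
  d-zero {u} {v} e with subst (Walk G u v) e (d-walk u v)
  ... | here = refl

  d-sym : ∀ u v → d u v ≡ d v u
  d-sym u v = ≤-antisym (d-min (reverse (d-walk v u))) (d-min (reverse (d-walk u v)))

  d-edge : ∀ {u v} → E G u v → d u v ≡ 1
  d-edge {u} {v} e with d u v | d-min (step e here) | d-zero {u} {v}
  ... | zero        | _          | z = ⊥-elim (E-irrefl u (subst (E G u) (sym (z refl)) e))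
  ... | suc zero    | _          | _ = refl
  ... | suc (suc _) | s≤s ()     | _

  edge-d : ∀ {u v} → d u v ≡ 1 → E G u v
  edge-d {u} {v} e with subst (Walk G u v) e (d-walk u v)
  ... | step f here = f

  d-lip : ∀ {x y} u → E G x y → d u y ≤ suc (d u x)
  d-lip u e = d-min (snoc (d-walk u _) e)

  d-geodesic : ∀ u v n → d u v ≡ suc n → ∃[ w ] (E G u w × d w v ≡ n)
  d-geodesic u v n e with subst (Walk G u v) e (d-walk u v)
  ... | step {b = w} f p = w , f , ≤-antisym (d-min p)
          (≤-pred (subst (_≤ suc (d w v)) e (subst₂ (λ i j → i ≤ suc j) (d-sym v u) (d-sym v w)
            (d-lip v (E-sym f)))))

-- Reflections produce parallelograms

module ReflectiveDistance (G : Graph) (simple : IsSimple G) (finite : IsFinite G)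
                          (connected : Connected G) (reflective : Reflective G) where
  open GraphDistance G simple finite connected
  open IsSimple simple using () renaming (sym to E-sym)

  nearer : ∀ {x y u} → d u x < d u y → InV G x y u
  nearer l = _ , _ , d-Dist _ _ , d-Dist _ _ , l

  equidistant : ∀ {x y u} → d u x ≡ d u y → InVeq G x y u
  equidistant {x} {u = u} e = d u x , d-Dist u x , subst (Dist G u _) (sym e) (d-Dist u _)

  module _ {x y : V G} (e : E G x y) where
    open Reflection (reflective x y e)

    φ-walk : ∀ {u v n} → Walk G u v n → Walk G (φ u) (φ v) n
    φ-walk here       = here
    φ-walk (step f p) = step (Equivalence.to (auto _ _) f) (φ-walk p)

    φ-isom : ∀ u v → d (φ u) (φ v) ≡ d u v
    φ-isom u v = ≤-antisym (d-min (φ-walk (d-walk u v)))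
      (subst₂ (λ u' v' → d u' v' ≤ d (φ u) (φ v)) (invol u) (invol v)
        (d-min (φ-walk (d-walk (φ u) (φ v)))))

    φ-swap : ∀ u v → d (φ u) v ≡ d u (φ v)
    φ-swap u v = trans (cong (d (φ u)) (sym (invol v))) (φ-isom u (φ v))

    φy≡x : φ y ≡ x
    φy≡x = trans (cong φ (sym φx≡y)) (invol x)

    far : ∀ {u} → d u x < d u y → d u y ≡ suc (d u x)
    far {u} l = ≤-antisym (d-lip u e) l

    far′ : ∀ {u} → d u y < d u x → d u x ≡ suc (d u y)
    far′ {u} l = ≤-antisym (d-lip u (E-sym e)) l

    φ-flip : ∀ {u} → d u y < d u x → d (φ u) x < d (φ u) y
    φ-flip {u} = subst₂ _<_ (trans (cong (d u) (sym φx≡y)) (sym (φ-swap u x)))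
                           (trans (cong (d u) (sym φy≡x)) (sym (φ-swap u y)))

    φ-flip′ : ∀ {u} → d u x < d u y → d (φ u) y < d (φ u) x
    φ-flip′ {u} = subst₂ _<_ (trans (cong (d u) (sym φy≡x)) (sym (φ-swap u y)))
                            (trans (cong (d u) (sym φx≡y)) (sym (φ-swap u x)))

    -- The folding of the graph along the reflection. It never lengthens a walk, which allows
    -- distances on the two sides to be compared.
    fold : V G → V G
    fold u with d u y <? d u x
    ... | yes _ = φ u
    ... | no  _ = u

    fold-near : ∀ {u} → d u x < d u y → fold u ≡ u
    fold-near {u} l with d u y <? d u x
    ... | yes m = ⊥-elim (<-asym l m)
    ... | no  _ = refl

    fold-far : ∀ {u} → d u y < d u x → fold u ≡ φ u
    fold-far {u} l with d u y <? d u x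
    ... | yes _ = refl
    ... | no ¬m = ⊥-elim (¬m l)

    -- An edge leaving the far side either reaches the near side, where `onlyEdge` makes it join a
    -- vertex to its mirror image, so that it collapses; or it ends in an equidistant vertex, which
    -- the reflection fixes.
    fold-edge-far : ∀ {u v} → d u y < d u x → ¬ d v y < d v x → E G u v →
                    φ u ≡ v ⊎ E G (φ u) v
    fold-edge-far {u} {v} l ¬m f with <-cmp (d v x) (d v y)
    ... | tri< m _ _ = inj₁ (trans (cong φ (onlyEdge v u (nearer m) (nearer l) (E-sym f))) (invol v))
    ... | tri≈ _ m _ = inj₂ (subst (E G (φ u)) (fixes v (equidistant m)) (Equivalence.to (auto u v) f))
    ... | tri> _ _ m = ⊥-elim (¬m m)

    fold-edge : ∀ {u v} → E G u v → fold u ≡ fold v ⊎ E G (fold u) (fold v)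
    fold-edge {u} {v} f with d u y <? d u x | d v y <? d v x
    ... | yes _ | yes _ = inj₂ (Equivalence.to (auto u v) f)
    ... | yes l | no ¬m = fold-edge-far l ¬m f
    ... | no ¬l | yes m = [ inj₁ ∘ sym , inj₂ ∘ E-sym ]′ (fold-edge-far m ¬l (E-sym f))
    ... | no _  | no _  = inj₂ f

    fold-walk : ∀ {u v n} → Walk G u v n → d (fold u) (fold v) ≤ n
    fold-walk here = ≤-reflexive (d-refl _)
    fold-walk {v = v} {n = suc n} (step {b = w} f p) with fold-edge f
    ... | inj₁ q = subst (λ z → d z (fold v) ≤ suc n) (sym q) (m≤n⇒m≤1+n (fold-walk p))
    ... | inj₂ g = ≤-trans (d-min (step g (d-walk (fold w) (fold v)))) (s≤s (fold-walk p))

    -- Folding fixes `v` and sends `φ u` back to `u`, so it turns a walk from `v` to `φ u` into one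
    -- from `v` to `u` that is no longer.
    fold-≤ : ∀ {u v} → d u x < d u y → d v x < d v y → d v u ≤ d v (φ u)
    fold-≤ {u} {v} l m = subst₂ (λ p q → d p q ≤ d v (φ u)) (fold-near m)
      (trans (fold-far (φ-flip′ l)) (invol u)) (fold-walk (d-walk v (φ u)))

  -- If v were equidistant from u and φ u, it would be fixed by the reflection in
  -- the edge from u to φ u, which exchanges x and y.
  beyond : ∀ {x y u v} (e : E G x y) → let open Reflection (reflective x y e) in
           E G u x → d u x < d u y → d v x < d v y → d v (φ u) ≡ suc (d v u)
  beyond {x} {y} {u} {v} e f l m with m≤n⇒m<n∨m≡n (fold-≤ e l m)
  ... | inj₁ k = ≤-antisym (d-lip v (proj₂ (Reflection.cross (reflective x y e) u (nearer l)))) k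
  ... | inj₂ k = ⊥-elim (<-irrefl v-eq m)
    where
    open Reflection (reflective x y e)
    g = proj₂ (cross u (nearer l))
    module Ψ = Reflection (reflective u (φ u) g)
    uy≡2 : d u y ≡ 2
    uy≡2 = trans (far e l) (cong suc (d-edge f))
    xu≡1 : d x u ≡ 1
    xu≡1 = d-edge (E-sym f)
    xφu≡2 : d x (φ u) ≡ 2
    xφu≡2 = trans (sym (φ-swap e x u)) (trans (cong (λ z → d z u) φx≡y) (trans (d-sym y u) uy≡2))
    yu≡2 : d y u ≡ 2
    yu≡2 = trans (d-sym y u) uy≡2
    yφu≡1 : d y (φ u) ≡ 1
    yφu≡1 = trans (sym (φ-swap e y u)) (trans (cong (λ z → d z u) (φy≡x e)) xu≡1)
    y≡ψx : y ≡ Ψ.φ x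
    y≡ψx = Ψ.onlyEdge x y (nearer (subst₂ _<_ (sym xu≡1) (sym xφu≡2) ≤-refl))
             (nearer (subst₂ _<_ (sym yφu≡1) (sym yu≡2) ≤-refl)) e
    v-eq : d v x ≡ d v y
    v-eq = trans (sym (φ-isom g v x)) (cong₂ d (Ψ.fixes v (equidistant k)) (sym y≡ψx))

  -- The fourth vertex is `φ u`. On the side of `x` the equation is `beyond`; an equidistant `v` is
  -- fixed by the reflection; for `v` on the side of `y`, `beyond` is applied to `φ v`.
  para-adjacent : ∀ {x y u} → E G x y → E G u x → d u y ≡ suc (d u x) →
                  ∃[ u' ] ∀ v → d u' v + d x v ≡ d u v + d y v
  para-adjacent {x} {y} {u} e f k = φ u , λ v →
      subst₂ _≡_ (cong₂ _+_ (d-sym v (φ u)) (d-sym v x)) (cong₂ _+_ (d-sym v u) (d-sym v y)) (eq v)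
    where
    open Reflection (reflective x y e)
    l : d u x < d u y
    l = ≤-reflexive (sym k)
    shift : ∀ {p q r s} → p ≡ suc q → r ≡ suc s → p + s ≡ q + r
    shift {q = q} {s = s} refl refl = sym (+-suc q s)
    eq : ∀ v → d v (φ u) + d v x ≡ d v u + d v y
    eq v with <-cmp (d v x) (d v y)
    ... | tri< m _ _ = shift (beyond e f l m) (far e m)
    ... | tri≈ _ m _ = cong₂ _+_ (trans (sym (φ-swap e v u)) (cong (λ z → d z u) (fixes v (equidistant m)))) m
    ... | tri> _ _ m = sym (shift
      (trans (trans (cong (λ z → d z u) (sym (invol v))) (φ-swap e (φ v) u))
        (trans (beyond e f l (φ-flip e m)) (cong suc (φ-swap e v u)))) (far′ e m))

  -- Induction on the distance from `u` to `x`. For a neighbour `w` of `u` nearer to `x`, the vertex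
  -- `w' = w − x + y` exists and is adjacent to `w`; then `u − w + w'` is a case of `para-adjacent`
  -- and equals `u − x + y`.
  para-at : ∀ n {x y u} → E G x y → d u y ≡ suc (d u x) → d u x ≡ n →
            ∃[ u' ] ∀ v → d u' v + d x v ≡ d u v + d y v
  para-at zero {x} {y} {u} e k l = y , λ v → trans (+-comm (d y v) (d x v)) (cong (λ z → d z v + d y v) (sym (d-zero l)))
  para-at (suc n) {x} {y} {u} e k l = u' , eq
    where
    near : ∃[ w ] (E G u w × d w x ≡ n)
    near = d-geodesic u x n l
    w  = proj₁ near
    uw = proj₁ (proj₂ near)
    wx = proj₂ (proj₂ near)
    wy : d w y ≡ suc (d w x)
    wy = ≤-antisym (d-lip w e) (≤-pred (subst₂ _≤_ (trans (d-sym y u) (trans k (cong suc (trans l (cong suc (sym wx))))))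
      (cong suc (d-sym y w)) (d-lip y (E-sym uw))))
    IH = para-at n e wy wx
    w' = proj₁ IH
    w'-eq : ∀ v → d w' v + d x v ≡ d w v + d y v
    w'-eq = proj₂ IH
    ww' : E G w w'
    ww' = E-sym (edge-d (+-cancelʳ-≡ (d x w) (d w' w) 1 (trans (w'-eq w)
      (cong₂ _+_ (d-refl w) (trans (d-sym y w) (trans wy (cong suc (d-sym w x))))))))
    uw' : d u w' ≡ suc (d u w)
    uw' = trans (d-sym u w') (+-cancelʳ-≡ (d x u) _ _ (trans (w'-eq u)
      (trans (cong₂ _+_ (d-sym w u) (trans (d-sym y u) (trans k (cong suc (d-sym u x))))) (+-suc _ _))))
    far-side = para-adjacent ww' uw uw'
    u' = proj₁ far-side
    eq : ∀ v → d u' v + d x v ≡ d u v + d y v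
    eq v = modulo (cong₂ _+_ (proj₂ far-side v) (w'-eq v))
      (rearrange (d u' v) (d x v) (d u v) (d w' v) (d w v) (d y v))
      where
      rearrange : ∀ p q r s t o → p + q + (r + s + (t + o)) ≡ r + o + (p + t + (s + q))
      rearrange = solve-∀

  graphMetric : ParMetric (V G)
  graphMetric = record
    { δ      = d
    ; δ-refl = d-refl
    ; δ-zero = d-zero
    ; δ-sym  = d-sym
    ; δ-lip  = λ u e → d-lip u (edge-d e)
    ; para   = λ e k → para-at _ (edge-d e) k refl
    }

  graphMetric-geodesic : Geodesic graphMetric
  graphMetric-geodesic u v n e = let w , f , k = d-geodesic u v n e in w , d-edge f , k

-- Restriction to subsets and local metrics

Σ-≡ : ∀ {A : Set} {P : A → Set} → (∀ {u} (p q : P u) → p ≡ q) →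
      {s t : Σ A P} → proj₁ s ≡ proj₁ t → s ≡ t
Σ-≡ irr {u , p} {.u , q} refl = cong (u ,_) (irr p q)

-- The subset has to contain the fourth vertex `u'`. `closed` may argue from the parallelogram
-- equation, as for level sets, or from the adjacency of `u'` and `u`, as for components.
restrict : ∀ {A} (M : ParMetric A) (P : A → Set) → (∀ {u} (p q : P u) → p ≡ q) →
           (∀ {x y u u'} → P x → P y → P u → δ M x y ≡ 1 →
              (∀ v → δ M u' v + δ M x v ≡ δ M u v + δ M y v) → δ M u' u ≡ 1 → P u') →
           ParMetric (Σ A P)
restrict M P irr closed = record
  { δ      = λ s t → δ M (proj₁ s) (proj₁ t)
  ; δ-refl = λ s → δ-refl M (proj₁ s)
  ; δ-zero = λ e → Σ-≡ irr (δ-zero M e)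
  ; δ-sym  = λ s t → δ-sym M (proj₁ s) (proj₁ t)
  ; δ-lip  = λ s → δ-lip M (proj₁ s)
  ; para   = λ { {x , p} {y , q} {u , r} e k →
      let u' , eq = para M e k in (u' , closed p q r e eq (adjacent e k eq)) , λ v → eq (proj₁ v) }
  }
  where
  adjacent : ∀ {x y u u'} → δ M x y ≡ 1 → δ M u y ≡ suc (δ M u x) →
             (∀ v → δ M u' v + δ M x v ≡ δ M u v + δ M y v) → δ M u' u ≡ 1
  adjacent {x} {y} {u} {u'} e k eq = +-cancelʳ-≡ (δ M x u) (δ M u' u) 1
    (trans (eq u) (trans (cong (_+ δ M y u) (δ-refl M u))
      (trans (δ-sym M y u) (trans k (cong suc (δ-sym M u x))))))

-- The distance to `o` is one at `x`, `y` and `u`, so the parallelogram equation at `o` makes it one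
-- at the fourth vertex. Distances are those of `M`, not of the induced subgraph.
Local : ∀ {A} (M : ParMetric A) (o : A) → ParMetric (Σ A (λ u → δ M o u ≡ 1))
Local M o = restrict M _ ≡-irrelevant λ {x} {y} {u} {u'} p q r _ eq _ →
  trans (δ-sym M o u') (+-cancelʳ-≡ (δ M x o) (δ M u' o) 1
    (trans (eq o) (cong₂ _+_ (trans (δ-sym M u o) r)
      (trans (δ-sym M y o) (trans q (sym (trans (δ-sym M x o) p)))))))

Local-bounded : ∀ {A} (M : ParMetric A) o s t → δ (Local M o) s t ≤ 2
Local-bounded M o (u , p) (v , q) =
  ≤-trans (δ-lip M u q) (s≤s (≤-reflexive (trans (δ-sym M u o) p)))

-- Reconstruction from one local metric

-- The vertices of M and of N that are the same affine combination, built from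
-- parallelograms, of a vertex and its neighbours.
module Development {A B : Set} (M : ParMetric A) (N : ParMetric B) (x : A) (x' : B)
                   (σ : Local M x ≃ Local N x') where
  infix 4 _~_
  data _~_ : A → B → Set where
    centre    : x ~ x'
    neighbour : ∀ s → proj₁ s ~ proj₁ (to σ s)
    fourth    : ∀ {v v' w w' y y' z z'} → w ~ w' → y ~ y' → z ~ z' →
                (∀ u → δ M v u + δ M w u ≡ δ M z u + δ M y u) →
                (∀ u → δ N v' u + δ N w' u ≡ δ N z' u + δ N y' u) → v ~ v'

  private
    transfer : ∀ {v v' w w' z z' y y'} → v + w ≡ z + y → v' + w' ≡ z' + y' →
               w ≡ w' → z ≡ z' → y ≡ y' → v ≡ v'
    transfer {v} {v'} {w} e f refl refl refl = +-cancelʳ-≡ w v v' (trans e (sym f))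

  -- The distances of a fourth vertex follow from those of the other three by the same equation in
  -- `M` and in `N`. The first argument is unfolded, then the second by symmetry, down to the centre
  -- and its neighbours, where `σ` is an isometry.
  ~-isom : ∀ {u u' v v'} → u ~ u' → v ~ v' → δ M u v ≡ δ N u' v'
  ~-isom centre centre = trans (δ-refl M x) (sym (δ-refl N x'))
  ~-isom centre (neighbour s) = trans (proj₂ s) (sym (proj₂ (to σ s)))
  ~-isom (neighbour s) centre = trans (δ-sym M _ _)
    (trans (proj₂ s) (trans (sym (proj₂ (to σ s))) (δ-sym N _ _)))
  ~-isom (neighbour s) (neighbour t) = sym (isom σ s t)
  ~-isom {v = v} {v'} (fourth p q r e f) h =
    transfer (e v) (f v') (~-isom p h) (~-isom r h) (~-isom q h)
  ~-isom {u} {u'} {v} {v'} g@centre (fourth {w = w} {w'} {y} {y'} {z} {z'} p q r e f) =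
    trans (δ-sym M u v) (trans (transfer (e u) (f u')
      (trans (δ-sym M w u) (trans (~-isom g p) (δ-sym N u' w')))
      (trans (δ-sym M z u) (trans (~-isom g r) (δ-sym N u' z')))
      (trans (δ-sym M y u) (trans (~-isom g q) (δ-sym N u' y')))) (δ-sym N v' u'))
  ~-isom {u} {u'} {v} {v'} g@(neighbour _) (fourth {w = w} {w'} {y} {y'} {z} {z'} p q r e f) =
    trans (δ-sym M u v) (trans (transfer (e u) (f u')
      (trans (δ-sym M w u) (trans (~-isom g p) (δ-sym N u' w')))
      (trans (δ-sym M z u) (trans (~-isom g r) (δ-sym N u' z')))
      (trans (δ-sym M y u) (trans (~-isom g q) (δ-sym N u' y')))) (δ-sym N v' u'))

  Developed : ℕ → Set
  Developed n = ∀ v → δ M v x ≡ n → ∃[ v' ] v ~ v'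

  -- With `v`, `y`, `w` the first vertices of a geodesic from `v` to `x`, the fourth vertex
  -- `z = w − y + v` is as far from `x` as `y` is. Hence `v = z − w + y` is expressed by vertices
  -- nearer to `x`, and `N` supplies the corresponding `v'`.
  develop-step : Geodesic M → ∀ {n} → Developed n → Developed (suc n) → Developed (suc (suc n))
  develop-step geo {n} IH₀ IH₁ v e = v' , fourth w~ y~ z~ v-eq (proj₂ N-para)
    where
    y-near = geo v x (suc n) e
    y  = proj₁ y-near
    vy : δ M v y ≡ 1
    vy = proj₁ (proj₂ y-near)
    yx : δ M y x ≡ suc n
    yx = proj₂ (proj₂ y-near)
    w-near = geo y x n yx
    w  = proj₁ w-near
    yw : δ M y w ≡ 1
    yw = proj₁ (proj₂ w-near)
    wx : δ M w x ≡ n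
    wx = proj₂ (proj₂ w-near)
    yv : δ M y v ≡ 1
    yv = trans (δ-sym M y v) vy
    wy : δ M w y ≡ 1
    wy = trans (δ-sym M w y) yw
    -- Since `w` is at distance `n` from `x`, a distance zero or one between `w` and `v` would put
    -- `v` within `n + 1` of `x`.
    wv : δ M w v ≡ suc (δ M w y)
    wv = ≤-antisym (δ-lip M w yv) (subst (λ m → suc m ≤ δ M w v) (sym wy) (lower (δ M w v) refl))
      where
      lower : ∀ m → δ M w v ≡ m → 2 ≤ m
      lower zero f = ⊥-elim (m≢1+n+m n {1} (trans (sym wx)
        (trans (cong (λ u → δ M u x) (δ-zero M f)) e)))
      lower (suc zero) f = ⊥-elim (1+n≰n (≤-trans (≤-reflexive (sym (trans (δ-sym M x v) e)))
        (≤-trans (δ-lip M x f) (s≤s (≤-reflexive (trans (δ-sym M x w) wx))))))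
      lower (suc (suc _)) f = s≤s (s≤s z≤n)
    M-para = para M yv wv
    z = proj₁ M-para
    z-eq : ∀ u → δ M z u + δ M y u ≡ δ M w u + δ M v u
    z-eq = proj₂ M-para
    zx : δ M z x ≡ suc n
    zx = +-cancelʳ-≡ (δ M y x) (δ M z x) (suc n) (trans (z-eq x)
      (trans (cong₂ _+_ wx e) (trans (+-suc n (suc n)) (cong (suc n +_) (sym yx)))))
    v-eq : ∀ u → δ M v u + δ M w u ≡ δ M z u + δ M y u
    v-eq u = trans (+-comm (δ M v u) (δ M w u)) (sym (z-eq u))
    w' = proj₁ (IH₀ w wx)
    w~ : w ~ w'
    w~ = proj₂ (IH₀ w wx)
    y' = proj₁ (IH₁ y yx)
    y~ : y ~ y'
    y~ = proj₂ (IH₁ y yx)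
    z' = proj₁ (IH₁ z zx)
    z~ : z ~ z'
    z~ = proj₂ (IH₁ z zx)
    zw : δ M z w ≡ 1
    zw = +-cancelʳ-≡ (δ M y w) (δ M z w) 1 (trans (z-eq w)
      (trans (cong₂ _+_ (δ-refl M w) (trans (δ-sym M v w) wv)) (cong suc (δ-sym M w y))))
    zy : δ M z y ≡ 2
    zy = trans (sym (+-identityʳ _)) (trans (cong (δ M z y +_) (sym (δ-refl M y)))
      (trans (z-eq y) (cong₂ _+_ wy vy)))
    N-para = para N {w'} {y'} {z'} (trans (sym (~-isom w~ y~)) wy)
      (trans (sym (~-isom z~ y~)) (trans zy (cong suc (trans (sym zw) (~-isom z~ w~)))))
    v' = proj₁ N-para

  develop : Geodesic M → ∀ n → Developed n
  develop geo zero v e = x' , subst (_~ x') (sym (δ-zero M e)) centre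
  develop geo (suc zero) v e = _ , neighbour (v , trans (δ-sym M x v) e)
  develop geo (suc (suc n)) = develop-step geo (develop geo n) (develop geo (suc n))

module _ {A B : Set} {M : ParMetric A} {N : ParMetric B} {x : A} {x' : B} where
  ~-flip : (σ : Local M x ≃ Local N x') → let open Development in
           ∀ {u u'} → _~_ N M x' x (≃-sym σ) u' u → _~_ M N x x' σ u u'
  ~-flip σ Development.centre = Development.centre
  ~-flip σ (Development.neighbour s) =
    subst (λ t → Development._~_ M N x x' σ (proj₁ (from σ s)) (proj₁ t)) (to-from σ s)
      (Development.neighbour (from σ s))
  ~-flip σ (Development.fourth p q r e f) =
    Development.fourth (~-flip σ p) (~-flip σ q) (~-flip σ r) f e

  -- Developing `M` gives images, and developing `N` along the inverse of `σ` gives preimages; the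
  -- relation preserves distances, so distance zero identifies the two sides.
  local-determines : Geodesic M → Geodesic N → Local M x ≃ Local N x' → M ≃ N
  local-determines geoM geoN σ = record
    { to      = λ u → proj₁ (image u)
    ; from    = λ u → proj₁ (preimage u)
    ; isom    = λ u v → sym (~-isom (proj₂ (image u)) (proj₂ (image v)))
    ; to-from = λ u → δ-zero N (trans (sym (~-isom (proj₂ (image (proj₁ (preimage u)))) (proj₂ (preimage u))))
                  (δ-refl M _))
    }
    where
    open Development M N x x' σ
    image : ∀ u → ∃[ u' ] u ~ u'
    image u = develop geoM _ u refl
    preimage : ∀ u' → ∃[ u ] u ~ u'
    preimage u' = let u , r = Development.develop N M x' x (≃-sym σ) geoN _ u' refl in u , ~-flip σ r

-- Products and disjoint unions

infixr 5 _⊗_ _⊕_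

-- The distance of the cartesian product. An edge changes a single coordinate, so its parallelograms
-- are completed in that factor.
_⊗_ : ∀ {A B} → ParMetric A → ParMetric B → ParMetric (A × B)
_⊗_ {A} {B} M N = record
  { δ      = D
  ; δ-refl = λ { (u , v) → cong₂ _+_ (δ-refl M u) (δ-refl N v) }
  ; δ-zero = λ { {u , v} {u' , v'} e → cong₂ _,_ (δ-zero M (m+n≡0⇒m≡0 (δ M u u') e))
                                                (δ-zero N (m+n≡0⇒n≡0 (δ M u u') e)) }
  ; δ-sym  = λ { (u , v) (u' , v') → cong₂ _+_ (δ-sym M u u') (δ-sym N v v') }
  ; δ-lip  = lip
  ; para   = par
  }
  where
  D : A × B → A × B → ℕ
  D (u , v) (u' , v') = δ M u u' + δ N v v'
  edge : ∀ {m n} → m + n ≡ 1 → (m ≡ 1 × n ≡ 0) ⊎ (m ≡ 0 × n ≡ 1)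
  edge {zero}        e = inj₂ (refl , e)
  edge {suc zero}    e = inj₁ (refl , suc-injective e)
  edge {suc (suc _)} ()
  lip : ∀ {p q} r → D p q ≡ 1 → D r q ≤ suc (D r p)
  lip {x , x'} {y , y'} (u , v) e with edge {δ M x y} e
  ... | inj₁ (f , g) with refl ← δ-zero N g = +-monoˡ-≤ (δ N v x') (δ-lip M u f)
  ... | inj₂ (f , g) with refl ← δ-zero M f =
    ≤-trans (+-monoʳ-≤ (δ M u x) (δ-lip N v g)) (≤-reflexive (+-suc _ _))
  par : ∀ {p q r} → D p q ≡ 1 → D r q ≡ suc (D r p) → ∃[ r' ] ∀ s → D r' s + D p s ≡ D r s + D q s
  par {x , x'} {y , y'} {u , v} e k with edge {δ M x y} e
  ... | inj₁ (f , g) with refl ← δ-zero N g =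
    let u' , eq = para M f (+-cancelʳ-≡ (δ N v x') _ _ k) in
    (u' , v) , λ { (s , t) → modulo (eq s)
      (rearrange (δ M u' s) (δ N v t) (δ M x s) (δ N x' t) (δ M u s) (δ M y s)) }
    where
    rearrange : ∀ p q r s t o → (p + q + (r + s)) + (t + o) ≡ (t + q + (o + s)) + (p + r)
    rearrange = solve-∀
  ... | inj₂ (f , g) with refl ← δ-zero M f =
    let v' , eq = para N g (+-cancelˡ-≡ (δ M u x) _ _ (trans k (sym (+-suc _ _)))) in
    (u , v') , λ { (s , t) → modulo (eq t)
      (rearrange (δ M u s) (δ N v' t) (δ M x s) (δ N x' t) (δ N v t) (δ N y' t)) }
    where
    rearrange : ∀ p q r s t o → (p + q + (r + s)) + (t + o) ≡ (p + t + (r + o)) + (q + s)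
    rearrange = solve-∀

⊗-geodesic : ∀ {A B} {M : ParMetric A} {N : ParMetric B} → Geodesic M → Geodesic N → Geodesic (M ⊗ N)
⊗-geodesic {M = M} {N} gM gN (u , u') (v , v') n e with δ M u v in eq
... | suc m = let w , f , k = gM u v m eq in
      (w , u') , cong₂ _+_ f (δ-refl N u') , trans (cong (_+ δ N u' v') k) (suc-injective e)
... | zero = let w , f , k = gN u' v' n e in
      (u , w) , cong₂ _+_ (δ-refl M u) f , trans (cong (_+ δ N w v') eq) k

-- Distance two between the summands is that of two non-adjacent neighbours of a common vertex. For
-- an edge in one summand and a vertex in the other, the hypothesis of `para` reads `2 ≡ 3`.
_⊕_ : ∀ {A B} → ParMetric A → ParMetric B → ParMetric (A ⊎ B)
_⊕_ {A} {B} M N = record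
  { δ      = D
  ; δ-refl = λ { (inj₁ u) → δ-refl M u ; (inj₂ u) → δ-refl N u }
  ; δ-zero = λ { {inj₁ u} {inj₁ v} e → cong inj₁ (δ-zero M e) ; {inj₂ u} {inj₂ v} e → cong inj₂ (δ-zero N e) }
  ; δ-sym  = λ { (inj₁ u) (inj₁ v) → δ-sym M u v ; (inj₁ _) (inj₂ _) → refl
               ; (inj₂ _) (inj₁ _) → refl ; (inj₂ u) (inj₂ v) → δ-sym N u v }
  ; δ-lip  = λ { {inj₁ x} {inj₁ y} (inj₁ u) e → δ-lip M u e ; {inj₁ x} {inj₁ y} (inj₂ u) e → n≤1+n 2
               ; {inj₂ x} {inj₂ y} (inj₂ u) e → δ-lip N u e ; {inj₂ x} {inj₂ y} (inj₁ u) e → n≤1+n 2 }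
  ; para   = λ {p} {q} {r} → par {p} {q} {r}
  }
  where
  D : A ⊎ B → A ⊎ B → ℕ
  D (inj₁ u) (inj₁ v) = δ M u v
  D (inj₁ _) (inj₂ _) = 2
  D (inj₂ _) (inj₁ _) = 2
  D (inj₂ u) (inj₂ v) = δ N u v
  par : ∀ {p q r} → D p q ≡ 1 → D r q ≡ suc (D r p) → ∃[ r' ] ∀ s → D r' s + D p s ≡ D r s + D q s
  par {inj₁ x} {inj₁ y} {inj₁ u} e k = let u' , eq = para M e k in
    inj₁ u' , λ { (inj₁ s) → eq s ; (inj₂ _) → refl }
  par {inj₂ x} {inj₂ y} {inj₂ u} e k = let u' , eq = para N e k in
    inj₂ u' , λ { (inj₂ s) → eq s ; (inj₁ _) → refl }

⊗-cong : ∀ {A B C D} {M : ParMetric A} {N : ParMetric B} {P : ParMetric C} {Q : ParMetric D} →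
         M ≃ P → N ≃ Q → M ⊗ N ≃ P ⊗ Q
⊗-cong e f = record
  { to      = λ { (u , v) → to e u , to f v }
  ; from    = λ { (u , v) → from e u , from f v }
  ; isom    = λ { (u , v) (u' , v') → cong₂ _+_ (isom e u u') (isom f v v') }
  ; to-from = λ { (u , v) → cong₂ _,_ (to-from e u) (to-from f v) }
  }

⊗-comm : ∀ {A B} {M : ParMetric A} {N : ParMetric B} → M ⊗ N ≃ N ⊗ M
⊗-comm {M = M} {N} = record
  { to      = λ { (u , v) → v , u }
  ; from    = λ { (u , v) → v , u }
  ; isom    = λ { (u , v) (u' , v') → +-comm (δ N v v') (δ M u u') }
  ; to-from = λ _ → refl
  }

⊕-cong : ∀ {A B C D} {M : ParMetric A} {N : ParMetric B} {P : ParMetric C} {Q : ParMetric D} →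
         M ≃ P → N ≃ Q → M ⊕ N ≃ P ⊕ Q
⊕-cong e f = record
  { to      = λ { (inj₁ u) → inj₁ (to e u) ; (inj₂ v) → inj₂ (to f v) }
  ; from    = λ { (inj₁ u) → inj₁ (from e u) ; (inj₂ v) → inj₂ (from f v) }
  ; isom    = λ { (inj₁ u) (inj₁ v) → isom e u v ; (inj₁ _) (inj₂ _) → refl
                ; (inj₂ _) (inj₁ _) → refl ; (inj₂ u) (inj₂ v) → isom f u v }
  ; to-from = λ { (inj₁ u) → cong inj₁ (to-from e u) ; (inj₂ v) → cong inj₂ (to-from f v) }
  }

Local-⊗ : ∀ {A B} {M : ParMetric A} {N : ParMetric B} o o' →
          Local (M ⊗ N) (o , o') ≃ Local M o ⊕ Local N o'
Local-⊗ {A} {B} {M} {N} o o' = ≃-sym (record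
  { to = into ; from = out ; isom = isom-into ; to-from = into-out })
  where
  into : Σ A (λ u → δ M o u ≡ 1) ⊎ Σ B (λ u → δ N o' u ≡ 1) →
         Σ (A × B) (λ s → δ (M ⊗ N) (o , o') s ≡ 1)
  into (inj₁ (u , e)) = (u , o') , cong₂ _+_ e (δ-refl N o')
  into (inj₂ (u , e)) = (o , u) , cong₂ _+_ (δ-refl M o) e
  isom-into : ∀ s t → δ (Local (M ⊗ N) (o , o')) (into s) (into t) ≡ δ (Local M o ⊕ Local N o') s t
  isom-into (inj₁ (u , e)) (inj₁ (v , f)) = trans (cong (δ M u v +_) (δ-refl N o')) (+-identityʳ _)
  isom-into (inj₁ (u , e)) (inj₂ (v , f)) = cong₂ _+_ (trans (δ-sym M u o) e) f
  isom-into (inj₂ (u , e)) (inj₁ (v , f)) = cong₂ _+_ f (trans (δ-sym N u o') e)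
  isom-into (inj₂ (u , e)) (inj₂ (v , f)) = cong (_+ δ N u v) (δ-refl M o)
  split : ∀ u v → δ M o u + δ N o' v ≡ 1 → ∃[ s ] proj₁ (into s) ≡ (u , v)
  split u v e with δ M o u in eq
  ... | zero        = inj₂ (v , e) , cong (_, v) (δ-zero M eq)
  ... | suc zero    = inj₁ (u , eq) , cong (u ,_) (δ-zero N (suc-injective e))
  out : Σ (A × B) (λ s → δ (M ⊗ N) (o , o') s ≡ 1) → Σ A (λ u → δ M o u ≡ 1) ⊎ Σ B (λ u → δ N o' u ≡ 1)
  out ((u , v) , e) = proj₁ (split u v e)
  into-out : ∀ s → into (out s) ≡ s
  into-out ((u , v) , e) = Σ-≡ ≡-irrelevant (proj₂ (split u v e))

point : ParMetric ⊤
point = record { δ = λ _ _ → 0 ; δ-refl = λ _ → refl ; δ-zero = λ _ → refl ; δ-sym = λ _ _ → refl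
               ; δ-lip = λ _ _ → z≤n ; para = λ () }

empty : ParMetric ⊥
empty = record { δ = λ () ; δ-refl = λ () ; δ-zero = λ { {()} } ; δ-sym = λ () ; δ-lip = λ { {()} } ; para = λ { {()} } }

empty-≃ : ∀ {A} {M : ParMetric A} → ¬ A → M ≃ empty
empty-≃ ¬A = record { to = ⊥-elim ∘ ¬A ; from = λ () ; isom = λ u → ⊥-elim (¬A u) ; to-from = λ () }

-- Hamming distance and parallelograms of binary words

β : Bool → Bool → ℕ
β false false = 0
β true  true  = 0
β false true  = 1
β true  false = 1

hdist-∷ : ∀ {n} p q (s t : Vec Bool n) → hdist (p ∷ s) (q ∷ t) ≡ β p q + hdist s t
hdist-∷ false false s t = refl
hdist-∷ true  true  s t = refl
hdist-∷ false true  s t = refl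
hdist-∷ true  false s t = refl

hdist-refl : ∀ {n} (s : Vec Bool n) → hdist s s ≡ 0
hdist-refl []          = refl
hdist-refl (false ∷ s) = hdist-refl s
hdist-refl (true ∷ s)  = hdist-refl s

hdist-zero : ∀ {n} {s t : Vec Bool n} → hdist s t ≡ 0 → s ≡ t
hdist-zero {s = []}        {[]}        e = refl
hdist-zero {s = false ∷ s} {false ∷ t} e = cong (false ∷_) (hdist-zero e)
hdist-zero {s = true ∷ s}  {true ∷ t}  e = cong (true ∷_) (hdist-zero e)

hdist-sym : ∀ {n} (s t : Vec Bool n) → hdist s t ≡ hdist t s
hdist-sym []          []          = refl
hdist-sym (false ∷ s) (false ∷ t) = hdist-sym s t
hdist-sym (true ∷ s)  (true ∷ t)  = hdist-sym s t
hdist-sym (false ∷ s) (true ∷ t)  = cong suc (hdist-sym s t)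
hdist-sym (true ∷ s)  (false ∷ t) = cong suc (hdist-sym s t)

β-triangle : ∀ p q r → β p r ≤ β p q + β q r
β-triangle false false r     = ≤-refl
β-triangle true  true  r     = ≤-refl
β-triangle false true  false = z≤n
β-triangle false true  true  = ≤-refl
β-triangle true  false true  = z≤n
β-triangle true  false false = ≤-refl

hdist-triangle : ∀ {n} (s t w : Vec Bool n) → hdist s w ≤ hdist s t + hdist t w
hdist-triangle []      []      []      = z≤n
hdist-triangle (p ∷ s) (q ∷ t) (r ∷ w)
  rewrite hdist-∷ p r s w | hdist-∷ p q s t | hdist-∷ q r t w =
  ≤-trans (+-mono-≤ (β-triangle p q r) (hdist-triangle s t w))
    (≤-reflexive (rearrange (β p q) (β q r) (hdist s t) (hdist t w)))
  where
  rearrange : ∀ x y z w → x + y + (z + w) ≡ x + z + (y + w)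
  rearrange = solve-∀

hdist-++ : ∀ {m n} (s s' : Vec Bool m) (t t' : Vec Bool n) →
           hdist (s ++ t) (s' ++ t') ≡ hdist s s' + hdist t t'
hdist-++ []      []        t t' = refl
hdist-++ (p ∷ s) (q ∷ s') t t'
  rewrite hdist-∷ p q (s ++ t) (s' ++ t') | hdist-∷ p q s s' =
  trans (cong (β p q +_) (hdist-++ s s' t t')) (sym (+-assoc (β p q) _ _))

hdist-∁ : ∀ {n} (s t : Vec Bool n) → hdist (∁ s) (∁ t) ≡ hdist s t
hdist-∁ []          []          = refl
hdist-∁ (false ∷ s) (false ∷ t) = hdist-∁ s t
hdist-∁ (true ∷ s)  (true ∷ t)  = hdist-∁ s t
hdist-∁ (false ∷ s) (true ∷ t)  = cong suc (hdist-∁ s t)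
hdist-∁ (true ∷ s)  (false ∷ t) = cong suc (hdist-∁ s t)

∁-involutive : ∀ {n} (s : Vec Bool n) → ∁ (∁ s) ≡ s
∁-involutive []          = refl
∁-involutive (p ∷ s) = cong₂ _∷_ (Bool.not-involutive p) (∁-involutive s)

hdist-⊥ : ∀ {n} (s : Vec Bool n) → hdist Subset.⊥ s ≡ ∣ s ∣
hdist-⊥ []          = refl
hdist-⊥ (false ∷ s) = hdist-⊥ s
hdist-⊥ (true ∷ s)  = cong suc (hdist-⊥ s)

hdist-⊤ : ∀ {n} (s : Vec Bool n) → hdist Subset.⊤ (∁ s) ≡ ∣ s ∣
hdist-⊤ []          = refl
hdist-⊤ (false ∷ s) = hdist-⊤ s
hdist-⊤ (true ∷ s)  = cong suc (hdist-⊤ s)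

∣∁∣ : ∀ {n} (s : Vec Bool n) → ∣ ∁ s ∣ + ∣ s ∣ ≡ n
∣∁∣ []          = refl
∣∁∣ (false ∷ s) = cong suc (∣∁∣ s)
∣∁∣ (true ∷ s)  = trans (+-suc _ _) (cong suc (∣∁∣ s))

∣++∣ : ∀ {m n} (s : Vec Bool m) (t : Vec Bool n) → ∣ s ++ t ∣ ≡ ∣ s ∣ + ∣ t ∣
∣++∣ []          t = refl
∣++∣ (false ∷ s) t = ∣++∣ s t
∣++∣ (true ∷ s)  t = cong suc (∣++∣ s t)

hdist-∩ : ∀ {n} (s t : Vec Bool n) → hdist s t + (∣ s ∩ t ∣ + ∣ s ∩ t ∣) ≡ ∣ s ∣ + ∣ t ∣
hdist-∩ []          []          = refl
hdist-∩ (false ∷ s) (false ∷ t) = hdist-∩ s t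
hdist-∩ (true ∷ s)  (false ∷ t) = cong suc (hdist-∩ s t)
hdist-∩ (false ∷ s) (true ∷ t)  = trans (cong suc (hdist-∩ s t)) (sym (+-suc _ _))
hdist-∩ (true ∷ s)  (true ∷ t)  = trans (rearrange (hdist s t) ∣ s ∩ t ∣)
  (trans (cong (2 +_) (hdist-∩ s t)) (cong suc (sym (+-suc _ _))))
  where
  rearrange : ∀ x y → x + (suc y + suc y) ≡ suc (suc (x + (y + y)))
  rearrange = solve-∀

-- The vector `u − x + y`, provided that `u` has the bit of `x` wherever `x` and `y` differ.
move : ∀ {n} → Vec Bool n → Vec Bool n → Vec Bool n → Vec Bool n
move []          []          []      = []
move (false ∷ x) (false ∷ y) (r ∷ u) = r ∷ move x y u
move (true ∷ x)  (true ∷ y)  (r ∷ u) = r ∷ move x y u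
move (false ∷ x) (true ∷ y)  (r ∷ u) = true ∷ move x y u
move (true ∷ x)  (false ∷ y) (r ∷ u) = false ∷ move x y u

private
  -- Excludes a bit in which `u` sides with `y` against `x`: it counts twice in
  -- `hdist u x + hdist x y` and not at all in `hdist u y`, against the triangle inequality.
  excess : ∀ {n} {x y u : Vec Bool n} → hdist u y ≡ suc (hdist u x + suc (hdist x y)) → ⊥
  excess {x = x} {y} {u} e = 1+n≰n (≤-trans (≤-reflexive (sym e))
    (≤-trans (hdist-triangle u x y) (+-monoʳ-≤ (hdist u x) (n≤1+n _))))

-- The hypothesis says that u agrees with x wherever x and y differ.
move-parallel : ∀ {n} (x y u v : Vec Bool n) → hdist u y ≡ hdist u x + hdist x y →
                hdist (move x y u) v + hdist x v ≡ hdist u v + hdist y v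
move-parallel []      []      []      []      e = refl
move-parallel (false ∷ x) (false ∷ y) (r ∷ u) (s ∷ v) e
  rewrite hdist-∷ r false u y | hdist-∷ r false u x | hdist-∷ r s (move x y u) v
        | hdist-∷ false s x v | hdist-∷ r s u v | hdist-∷ false s y v =
  modulo (move-parallel x y u v (+-cancelˡ-≡ (β r false) _ _ (trans e (+-assoc (β r false) _ _))))
    (rearrange (β r s) (β false s) (hdist (move x y u) v) (hdist x v) (hdist u v) (hdist y v))
  where
  rearrange : ∀ r s a x u y → r + a + (s + x) + (u + y) ≡ r + u + (s + y) + (a + x)
  rearrange = solve-∀
move-parallel (true ∷ x) (true ∷ y) (r ∷ u) (s ∷ v) e
  rewrite hdist-∷ r true u y | hdist-∷ r true u x | hdist-∷ r s (move x y u) v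
        | hdist-∷ true s x v | hdist-∷ r s u v | hdist-∷ true s y v =
  modulo (move-parallel x y u v (+-cancelˡ-≡ (β r true) _ _ (trans e (+-assoc (β r true) _ _))))
    (rearrange (β r s) (β true s) (hdist (move x y u) v) (hdist x v) (hdist u v) (hdist y v))
  where
  rearrange : ∀ r s a x u y → r + a + (s + x) + (u + y) ≡ r + u + (s + y) + (a + x)
  rearrange = solve-∀
move-parallel (false ∷ x) (true ∷ y) (true ∷ u) (s ∷ v) e = ⊥-elim (excess {x = x} {y} {u} e)
move-parallel (true ∷ x) (false ∷ y) (false ∷ u) (s ∷ v) e = ⊥-elim (excess {x = x} {y} {u} e)
move-parallel (false ∷ x) (true ∷ y) (false ∷ u) (s ∷ v) e
  rewrite hdist-∷ true s (move x y u) v | hdist-∷ false s x v | hdist-∷ false s u v | hdist-∷ true s y v =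
  modulo (move-parallel x y u v (suc-injective (trans e (+-suc _ _))))
    (rearrange (β true s) (β false s) (hdist (move x y u) v) (hdist x v) (hdist u v) (hdist y v))
  where
  rearrange : ∀ r s a x u y → r + a + (s + x) + (u + y) ≡ s + u + (r + y) + (a + x)
  rearrange = solve-∀
move-parallel (true ∷ x) (false ∷ y) (true ∷ u) (s ∷ v) e
  rewrite hdist-∷ false s (move x y u) v | hdist-∷ true s x v | hdist-∷ true s u v | hdist-∷ false s y v =
  modulo (move-parallel x y u v (suc-injective (trans e (+-suc _ _))))
    (rearrange (β false s) (β true s) (hdist (move x y u) v) (hdist x v) (hdist u v) (hdist y v))
  where
  rearrange : ∀ r s a x u y → r + a + (s + x) + (u + y) ≡ s + u + (r + y) + (a + x)
  rearrange = solve-∀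

-- Codes with even distances: Johnson graphs and halved cubes

half-double : ∀ n → n % 2 ≡ 0 → ⌊ n /2⌋ + ⌊ n /2⌋ ≡ n
half-double zero          e = refl
half-double (suc (suc n)) e = cong suc (trans (+-suc _ _) (cong suc (half-double n e)))

even-double : ∀ m n → (n + (m + m)) % 2 ≡ n % 2
even-double zero    n = cong (_% 2) (+-identityʳ n)
even-double (suc m) n = trans (cong (_% 2) (rearrange n m)) (even-double m n)
  where
  rearrange : ∀ n m → n + (suc m + suc m) ≡ suc (suc (n + (m + m)))
  rearrange = solve-∀

double-injective : ∀ {m n} → m + m ≡ n + n → m ≡ n
double-injective {m} {n} e = trans (n≡⌊n+n/2⌋ m) (trans (cong ⌊_/2⌋ e) (sym (n≡⌊n+n/2⌋ n)))

interchange : ∀ m n → m + n + (m + n) ≡ m + m + (n + n)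
interchange = solve-∀

-- Common frame for Johnson graphs and halved cubes: in both, the graph distance is half the Hamming
-- distance.
record Code (n : ℕ) : Set₁ where
  field
    Word       : Vec Bool n → Set
    irrelevant : ∀ {s} (p q : Word s) → p ≡ q
    even       : ∀ {s t} → Word s → Word t → hdist s t % 2 ≡ 0
    closed     : ∀ {x y u u'} → Word x → Word y → Word u →
                 (∀ v → hdist u' v + hdist x v ≡ hdist u v + hdist y v) → Word u'

  half : Σ _ Word → Σ _ Word → ℕ
  half (s , _) (t , _) = ⌊ hdist s t /2⌋

  half+half : ∀ s t → half s t + half s t ≡ hdist (proj₁ s) (proj₁ t)
  half+half (s , p) (t , q) = half-double (hdist s t) (even p q)

  codeMetric : ParMetric (Σ _ Word)
  codeMetric = record
    { δ      = half
    ; δ-refl = λ { (s , _) → cong ⌊_/2⌋ (hdist-refl s) }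
    ; δ-zero = λ {s} {t} e → Σ-≡ irrelevant (hdist-zero (trans (sym (half+half s t)) (cong₂ _+_ e e)))
    ; δ-sym  = λ { (s , _) (t , _) → cong ⌊_/2⌋ (hdist-sym s t) }
    ; δ-lip  = λ {x} {y} u e → ⌊n/2⌋-mono (≤-trans (hdist-triangle (proj₁ u) (proj₁ x) (proj₁ y))
                 (≤-reflexive (trans (cong (hdist (proj₁ u) (proj₁ x) +_) (edge x y e)) (+-comm _ 2))))
    ; para   = λ {x} {y} {u} e k → fourth x y u (parallel x y u e k)
    }
    where
    edge : ∀ x y → half x y ≡ 1 → hdist (proj₁ x) (proj₁ y) ≡ 2
    edge x y e = trans (sym (half+half x y)) (cong₂ _+_ e e)
    parallel : ∀ x y u → half x y ≡ 1 → half u y ≡ suc (half u x) → ∀ v →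
      hdist (move (proj₁ x) (proj₁ y) (proj₁ u)) v + hdist (proj₁ x) v ≡ hdist (proj₁ u) v + hdist (proj₁ y) v
    -- Doubled, `e` and `k` say that `x` lies on a geodesic of the cube from `u` to `y`.
    parallel x y u e k v = move-parallel (proj₁ x) (proj₁ y) (proj₁ u) v
      (trans (sym (half+half u y)) (trans (cong₂ _+_ k k)
        (trans (cong suc (+-suc _ _)) (trans (+-comm 2 _) (cong₂ _+_ (half+half u x) (sym (edge x y e)))))))
    fourth : ∀ x y u → (∀ v → hdist (move (proj₁ x) (proj₁ y) (proj₁ u)) v + hdist (proj₁ x) v
                             ≡ hdist (proj₁ u) v + hdist (proj₁ y) v) →
             ∃[ u' ] ∀ v → half u' v + half x v ≡ half u v + half y v
    fourth x y u par = u' , λ v → double-injective (trans (interchange (half u' v) (half x v))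
      (trans (cong₂ _+_ (half+half u' v) (half+half x v)) (trans (par (proj₁ v))
        (trans (sym (cong₂ _+_ (half+half u v) (half+half y v))) (sym (interchange (half u v) (half y v)))))))
      where
      u' : Σ _ Word
      u' = move (proj₁ x) (proj₁ y) (proj₁ u) , closed (proj₂ x) (proj₂ y) (proj₂ u) par
open Code using (codeMetric)

-- The weight is the distance to the empty set, hence affine on parallelograms; this closes both the
-- words of fixed weight and those of even weight.
parallel-weight : ∀ {n} (x y u u' : Vec Bool n) →
  (∀ v → hdist u' v + hdist x v ≡ hdist u v + hdist y v) → ∣ u' ∣ + ∣ x ∣ ≡ ∣ u ∣ + ∣ y ∣
parallel-weight x y u u' par =
  subst₂ _≡_ (cong₂ _+_ (weight u') (weight x)) (cong₂ _+_ (weight u) (weight y)) (par Subset.⊥)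
  where
  weight : ∀ s → hdist s Subset.⊥ ≡ ∣ s ∣
  weight s = trans (hdist-sym s _) (hdist-⊥ s)

johnsonCode : ∀ n k → Code n
johnsonCode n k = record
  { Word       = λ s → ∣ s ∣ ≡ k
  ; irrelevant = ≡-irrelevant
  ; even       = λ {s} {t} p q → trans (sym (even-double ∣ s ∩ t ∣ (hdist s t)))
                   (trans (cong (_% 2) (trans (hdist-∩ s t) (cong₂ _+_ p q))) (even-double k 0))
  ; closed     = λ {x} {y} {u} {u'} p q r par → +-cancelʳ-≡ ∣ x ∣ ∣ u' ∣ k
                   (trans (parallel-weight x y u u' par) (cong₂ _+_ r (trans q (sym p))))
  }

johnson-metric : ∀ n k → ParMetric (Σ (Subset n) (λ s → ∣ s ∣ ≡ k))
johnson-metric n k = codeMetric (johnsonCode n k)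

halvedCode : ∀ n → Code n
halvedCode n = record
  { Word       = λ s → ∣ s ∣ % 2 ≡ 0
  ; irrelevant = ≡-irrelevant
  ; even       = λ {s} {t} p q → trans (sym (even-double ∣ s ∩ t ∣ (hdist s t)))
                   (trans (cong (_% 2) (hdist-∩ s t)) (sum-even ∣ s ∣ ∣ t ∣ p q))
  ; closed     = λ {x} {y} {u} {u'} p q r par → difference-even ∣ u' ∣ ∣ x ∣ p
                   (trans (cong (_% 2) (parallel-weight x y u u' par)) (sum-even ∣ u ∣ ∣ y ∣ r q))
  }
  where
  sum-even : ∀ m n → m % 2 ≡ 0 → n % 2 ≡ 0 → (m + n) % 2 ≡ 0
  sum-even m n p q = trans (cong (λ k → (m + k) % 2) (sym (half-double n q))) (trans (even-double ⌊ n /2⌋ m) p)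
  difference-even : ∀ m n → n % 2 ≡ 0 → (m + n) % 2 ≡ 0 → m % 2 ≡ 0
  difference-even m n p q = trans (sym (even-double ⌊ n /2⌋ m))
    (trans (cong (λ k → (m + k) % 2) (half-double n p)) q)

halved-metric : ∀ n → ParMetric (Σ (Subset n) (λ s → ∣ s ∣ % 2 ≡ 0))
halved-metric n = codeMetric (halvedCode n)

add : ∀ {n} (s t : Vec Bool n) → ∣ s ∣ < ∣ t ∣ →
      ∃[ w ] (∣ w ∣ ≡ suc ∣ s ∣ × hdist s w ≡ 1 × hdist s t ≡ suc (hdist w t))
add []          []          ()
add (false ∷ s) (true ∷ t)  l = true ∷ s , refl , cong suc (hdist-refl s) , refl
add (true ∷ s)  (false ∷ t) l = let w , p , q , r = add s t (<-trans (n<1+n _) l) in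
  true ∷ w , cong suc p , q , cong suc r
add (false ∷ s) (false ∷ t) l = let w , p , q , r = add s t l in false ∷ w , p , q , r
add (true ∷ s)  (true ∷ t)  l = let w , p , q , r = add s t (≤-pred l) in true ∷ w , cong suc p , q , r

remove : ∀ {n} (s t : Vec Bool n) → ∣ t ∣ < ∣ s ∣ →
         ∃[ w ] (suc ∣ w ∣ ≡ ∣ s ∣ × hdist s w ≡ 1 × hdist s t ≡ suc (hdist w t))
remove []          []          ()
remove (true ∷ s)  (false ∷ t) l = false ∷ s , refl , cong suc (hdist-refl s) , refl
remove (false ∷ s) (true ∷ t)  l = let w , p , q , r = remove s t (<-trans (n<1+n _) l) in
  false ∷ w , p , q , cong suc r
remove (false ∷ s) (false ∷ t) l = let w , p , q , r = remove s t l in false ∷ w , p , q , r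
remove (true ∷ s)  (true ∷ t)  l = let w , p , q , r = remove s t (≤-pred l) in true ∷ w , cong suc p , q , r

-- The first differing bit is set as in `t`. As the weights agree, the tails then have weights one
-- apart, and `add` or `remove` compensates at another place where the words differ.
exchange : ∀ {n h} (s t : Vec Bool n) → ∣ s ∣ ≡ ∣ t ∣ → hdist s t ≡ suc h →
           ∃[ w ] (∣ w ∣ ≡ ∣ s ∣ × hdist s w ≡ 2 × hdist s t ≡ 2 + hdist w t)
exchange []          []          e ()
exchange (false ∷ s) (false ∷ t) e h = let w , p , q , r = exchange s t e h in false ∷ w , p , q , r
exchange (true ∷ s)  (true ∷ t)  e h = let w , p , q , r = exchange s t (suc-injective e) h in
  true ∷ w , cong suc p , q , r
exchange (false ∷ s) (true ∷ t)  e h = let w , p , q , r = remove s t (≤-reflexive (sym e)) in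
  true ∷ w , p , cong suc q , cong suc r
exchange (true ∷ s)  (false ∷ t) e h = let w , p , q , r = add s t (≤-reflexive e) in
  false ∷ w , p , cong suc q , cong suc r

johnson-geodesic : ∀ n k → Geodesic (johnson-metric n k)
johnson-geodesic n k (s , p) (t , q) m e with hdist s t in eq
... | suc (suc h) = let w , f , g , l = exchange s t (trans p (sym q)) eq in
      (w , trans f p) , cong ⌊_/2⌋ g ,
      trans (cong ⌊_/2⌋ (suc-injective (suc-injective (trans (sym l) eq)))) (suc-injective e)

flip : ∀ {n h} (s t : Vec Bool n) → hdist s t ≡ suc h → ∃[ w ] (hdist s w ≡ 1 × hdist w t ≡ h)
flip []          []          ()
flip (false ∷ s) (false ∷ t) e = let w , p , q = flip s t e in false ∷ w , p , q
flip (true ∷ s)  (true ∷ t)  e = let w , p , q = flip s t e in true ∷ w , p , q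
flip (false ∷ s) (true ∷ t)  e = true ∷ s , cong suc (hdist-refl s) , suc-injective e
flip (true ∷ s)  (false ∷ t) e = false ∷ s , cong suc (hdist-refl s) , suc-injective e

-- Two single flips towards `t`; the even distance to `s` shows that the weight is even again.
halved-geodesic : ∀ n → Geodesic (halved-metric n)
halved-geodesic n (s , p) (t , q) m e with hdist s t in eq
... | suc (suc h) = (w' , even-w') , cong ⌊_/2⌋ sw'≡2 , trans (cong ⌊_/2⌋ w't≡h) (suc-injective e)
  where
  first = flip s t eq
  w = proj₁ first
  second = flip w t (proj₂ (proj₂ first))
  w' = proj₁ second
  w't≡h : hdist w' t ≡ h
  w't≡h = proj₂ (proj₂ second)
  sw'≡2 : hdist s w' ≡ 2
  sw'≡2 = ≤-antisym (≤-trans (hdist-triangle s w w')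
      (≤-reflexive (cong₂ _+_ (proj₁ (proj₂ first)) (proj₁ (proj₂ second)))))
    (+-cancelʳ-≤ h 2 _ (≤-trans (≤-reflexive (sym eq)) (≤-trans (hdist-triangle s w' t)
      (≤-reflexive (cong (hdist s w' +_) w't≡h)))))
  even-w' : ∣ w' ∣ % 2 ≡ 0
  even-w' = trans (sym (even-double ⌊ ∣ s ∣ /2⌋ ∣ w' ∣)) (trans (cong (_% 2)
    (trans (cong (∣ w' ∣ +_) (half-double ∣ s ∣ p)) (trans (+-comm ∣ w' ∣ ∣ s ∣) (sym (hdist-∩ s w')))))
    (trans (even-double ∣ s ∩ w' ∣ (hdist s w')) (cong (_% 2) sw'≡2)))

johnson-edge : ∀ {n k} (s t : V (Johnson n k)) → E (Johnson n k) s t ⇔ δ (johnson-metric n k) s t ≡ 1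
johnson-edge {n} {k} (s , p) (t , q) = mk⇔
  (λ e → cong ⌊_/2⌋ (+-cancelʳ-≡ (∣ s ∩ t ∣ + ∣ s ∩ t ∣) (hdist s t) 2
    (trans weights (trans (cong₂ _+_ (sym e) (sym e)) (cong suc (+-suc _ _))))))
  (λ e → double-injective (trans (cong suc (+-suc _ _)) (trans (cong (_+ (∣ s ∩ t ∣ + ∣ s ∩ t ∣))
    (trans (sym (cong₂ _+_ e e)) (Code.half+half (johnsonCode n k) (s , p) (t , q)))) weights)))
  where
  weights : hdist s t + (∣ s ∩ t ∣ + ∣ s ∩ t ∣) ≡ k + k
  weights = trans (hdist-∩ s t) (cong₂ _+_ p q)

halved-edge : ∀ {n} (s t : V (HalvedCube n)) → E (HalvedCube n) s t ⇔ δ (halved-metric n) s t ≡ 1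
halved-edge {n} s t = mk⇔ (cong ⌊_/2⌋)
  (λ e → trans (sym (Code.half+half (halvedCode n) s t)) (cong₂ _+_ e e))

∣⊥∣%2 : ∀ n → ∣ Subset.⊥ {n} ∣ % 2 ≡ 0
∣⊥∣%2 n = cong (_% 2) (∣⊥∣≡0 n)

halved-origin : ∀ n → V (HalvedCube n)
halved-origin n = Subset.⊥ , ∣⊥∣%2 n

-- The neighbours of the empty set are the pairs.
Local-halved : ∀ n → Local (halved-metric n) (halved-origin n) ≃ johnson-metric n 2
Local-halved n = record
  { to      = λ { ((s , p) , e) → s , trans (sym (hdist-⊥ s))
                (trans (sym (Code.half+half (halvedCode n) (halved-origin n) (s , p))) (cong₂ _+_ e e)) }
  ; from    = λ { (s , p) → (s , cong (_% 2) p) , cong ⌊_/2⌋ (trans (hdist-⊥ s) p) }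
  ; isom    = λ _ _ → refl
  ; to-from = λ _ → Σ-≡ ≡-irrelevant refl
  }

johnson-origin : ∀ m n → V (Johnson (m + n) m)
johnson-origin m n = Subset.⊤ {m} ++ Subset.⊥ {n} ,
  trans (∣++∣ (Subset.⊤ {m}) (Subset.⊥ {n})) (trans (cong₂ _+_ (∣⊤∣≡n m) (∣⊥∣≡0 n)) (+-identityʳ m))

-- A neighbour of the set of the first `m` points loses one of them and gains one of the other `n`.
-- Note that `johnson-metric k 1` is the metric of the complete graph on `k` vertices.
Local-johnson : ∀ m n → Local (johnson-metric (m + n) m) (johnson-origin m n)
                      ≃ johnson-metric m 1 ⊗ johnson-metric n 1
Local-johnson m n = ≃-sym (record
  { to      = into
  ; from    = out
  ; isom    = λ { ((s , p) , (t , q)) ((s' , p') , (t' , q')) → double-injective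
      (trans (Code.half+half (johnsonCode (m + n) m) (proj₁ (into ((s , p) , t , q))) (proj₁ (into ((s' , p') , t' , q'))))
        (trans (hdist-++ (∁ s) (∁ s') t t') (trans (cong (_+ hdist t t') (hdist-∁ s s'))
          (trans (sym (cong₂ _+_ (Code.half+half (johnsonCode m 1) (s , p) (s' , p'))
                                 (Code.half+half (johnsonCode n 1) (t , q) (t' , q'))))
            (sym (interchange ⌊ hdist s s' /2⌋ ⌊ hdist t t' /2⌋)))))) }
  ; to-from = λ { ((w , p) , e) → Σ-≡ ≡-irrelevant (Σ-≡ ≡-irrelevant
      (trans (cong (_++ drop m w) (∁-involutive (take m w))) (Vec.take++drop≡id m w))) }
  })
  where
  into : Σ (Subset m) (λ s → ∣ s ∣ ≡ 1) × Σ (Subset n) (λ s → ∣ s ∣ ≡ 1) →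
         Σ (V (Johnson (m + n) m)) (λ w → δ (johnson-metric (m + n) m) (johnson-origin m n) w ≡ 1)
  into ((s , p) , (t , q)) =
    (∁ s ++ t , trans (∣++∣ (∁ s) t) (trans (cong (∣ ∁ s ∣ +_) (trans q (sym p))) (∣∁∣ s))) ,
    cong ⌊_/2⌋ (trans (hdist-++ (Subset.⊤ {m}) (∁ s) (Subset.⊥ {n}) t)
      (cong₂ _+_ (trans (hdist-⊤ s) p) (trans (hdist-⊥ t) q)))
  out : Σ (V (Johnson (m + n) m)) (λ w → δ (johnson-metric (m + n) m) (johnson-origin m n) w ≡ 1) →
        Σ (Subset m) (λ s → ∣ s ∣ ≡ 1) × Σ (Subset n) (λ s → ∣ s ∣ ≡ 1)
  out ((w , p) , e) = (s , double-injective (trans (cong (∣ s ∣ +_) (sym s≡t)) total)) ,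
                      (t , double-injective (trans (cong (_+ ∣ t ∣) s≡t) total))
    where
    s = ∁ (take m w)
    t = drop m w
    w≡ : ∁ s ++ t ≡ w
    w≡ = trans (cong (_++ t) (∁-involutive (take m w))) (Vec.take++drop≡id m w)
    s≡t : ∣ t ∣ ≡ ∣ s ∣
    s≡t = +-cancelˡ-≡ ∣ ∁ s ∣ _ _ (trans (sym (∣++∣ (∁ s) t)) (trans (cong ∣_∣ w≡) (trans p (sym (∣∁∣ s)))))
    total : ∣ s ∣ + ∣ t ∣ ≡ 1 + 1
    total = trans (sym (trans (hdist-++ (Subset.⊤ {m}) (∁ s) (Subset.⊥ {n}) t)
        (cong₂ _+_ (hdist-⊤ s) (hdist-⊥ t))))
      (trans (cong (hdist (Subset.⊤ {m} ++ Subset.⊥ {n})) w≡)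
        (trans (sym (Code.half+half (johnsonCode (m + n) m) (johnson-origin m n) (w , p))) (cong₂ _+_ e e)))

-- Cocktail party graphs

module Cocktail (k : ℕ) where
  P = V (CocktailParty k)

  -- `β p q` is doubled because the two vertices of a pair are at distance two.
  cocktailδ : P → P → ℕ
  cocktailδ (i , p) (j , q) = if does (i Fin.≟ j) then β p q + β p q else 1

  antipode : P → P
  antipode (i , p) = i , not p

  different : ∀ {u v} → proj₁ u ≢ proj₁ v → cocktailδ u v ≡ 1
  different {i , _} {j , _} ne with i Fin.≟ j
  ... | yes e = ⊥-elim (ne e)
  ... | no  _ = refl

  same : ∀ i p q → cocktailδ (i , p) (i , q) ≡ β p q + β p q
  same i p q with i Fin.≟ i
  ... | yes _ = refl
  ... | no ne = ⊥-elim (ne refl)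

  relation : ∀ u v → u ≡ v ⊎ u ≡ antipode v ⊎ proj₁ u ≢ proj₁ v
  relation (i , p) (j , q) with i Fin.≟ j
  ... | no ne = inj₂ (inj₂ ne)
  relation (i , false) (.i , false) | yes refl = inj₁ refl
  relation (i , true)  (.i , true)  | yes refl = inj₁ refl
  relation (i , false) (.i , true)  | yes refl = inj₂ (inj₁ refl)
  relation (i , true)  (.i , false) | yes refl = inj₂ (inj₁ refl)

  cocktailδ-refl : ∀ u → cocktailδ u u ≡ 0
  cocktailδ-refl (i , false) = same i false false
  cocktailδ-refl (i , true)  = same i true true

  δ-antipode : ∀ u → cocktailδ (antipode u) u ≡ 2
  δ-antipode (i , false) = same i true false
  δ-antipode (i , true)  = same i false true

  -- All antipodal pairs have the same sum, so `antipode x + x = antipode y + y`. This is the only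
  -- kind of parallelogram with `u` different from `x`.
  antipode-sum : ∀ u v → cocktailδ (antipode u) v + cocktailδ u v ≡ 2
  antipode-sum (i , p) (j , q) with i Fin.≟ j
  antipode-sum (i , false) (j , false) | yes _ = refl
  antipode-sum (i , true)  (j , false) | yes _ = refl
  antipode-sum (i , false) (j , true)  | yes _ = refl
  antipode-sum (i , true)  (j , true)  | yes _ = refl
  ... | no _ = refl

  edge-different : ∀ {u v} → cocktailδ u v ≡ 1 → proj₁ u ≢ proj₁ v
  edge-different {u} {v} e ne with relation u v
  ... | inj₁ refl        = 0≢1+n (trans (sym (cocktailδ-refl u)) e)
  ... | inj₂ (inj₁ refl) = 1+n≢n (trans (sym (δ-antipode v)) e)
  ... | inj₂ (inj₂ n)    = n ne

  cocktailδ-sym : ∀ u v → cocktailδ u v ≡ cocktailδ v u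
  cocktailδ-sym u v with relation u v
  ... | inj₁ refl         = refl
  ... | inj₂ (inj₁ refl)  = antipodes v
    where
    antipodes : ∀ v → cocktailδ (antipode v) v ≡ cocktailδ v (antipode v)
    antipodes (i , false) = trans (same i true false) (sym (same i false true))
    antipodes (i , true)  = trans (same i false true) (sym (same i true false))
  ... | inj₂ (inj₂ ne)    = trans (different {u} {v} ne) (sym (different {v} {u} (ne ∘ sym)))

  cocktailδ-≤2 : ∀ u v → cocktailδ u v ≤ 2
  cocktailδ-≤2 u v = ≤-trans (m≤n+m _ _) (≤-reflexive (antipode-sum u v))

  cocktailδ-zero : ∀ {u v} → cocktailδ u v ≡ 0 → u ≡ v
  cocktailδ-zero {u} {v} e with relation u v
  ... | inj₁ q           = q
  ... | inj₂ (inj₁ refl) = ⊥-elim (0≢1+n (trans (sym e) (δ-antipode v)))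
  ... | inj₂ (inj₂ ne)   = ⊥-elim (0≢1+n (trans (sym e) (different {u} {v} ne)))

  cocktail-metric : ParMetric P
  cocktail-metric = record
    { δ      = cocktailδ
    ; δ-refl = cocktailδ-refl
    ; δ-zero = cocktailδ-zero
    ; δ-sym  = cocktailδ-sym
    ; δ-lip  = λ {x} {y} u → lip {x} {y} u
    ; para   = λ {x} {y} {u} → par {x} {y} {u}
    }
    where
    lip : ∀ {x y} u → cocktailδ x y ≡ 1 → cocktailδ u y ≤ suc (cocktailδ u x)
    lip {x} {y} u e with cocktailδ u x in eq
    ... | zero  = ≤-reflexive (trans (cong (λ v → cocktailδ v y) (cocktailδ-zero {u} {x} eq)) e)
    ... | suc _ = ≤-trans (cocktailδ-≤2 u y) (s≤s (s≤s z≤n))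
    par : ∀ {x y u} → cocktailδ x y ≡ 1 → cocktailδ u y ≡ suc (cocktailδ u x) →
          ∃[ u' ] ∀ v → cocktailδ u' v + cocktailδ x v ≡ cocktailδ u v + cocktailδ y v
    par {x} {y} {u} e f with relation u y
    ... | inj₁ refl        = ⊥-elim (0≢1+n (trans (sym (cocktailδ-refl u)) f))
    ... | inj₂ (inj₁ refl) = antipode x , λ v → trans (antipode-sum x v) (sym (antipode-sum y v))
    ... | inj₂ (inj₂ ne)   = y , λ v → trans (+-comm (cocktailδ y v) _)
          (cong (λ w → cocktailδ w v + cocktailδ y v) (sym (cocktailδ-zero {u} {x}
            (suc-injective (trans (sym f) (different {u} {y} ne))))))

  cocktail-edge : ∀ u v → E (CocktailParty k) u v ⇔ cocktailδ u v ≡ 1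
  cocktail-edge u v = mk⇔ (different {u} {v}) (edge-different {u} {v})
open Cocktail using (cocktail-metric; cocktail-edge)

-- At least two pairs are required for antipodes to have a common neighbour.
cocktail-geodesic : ∀ k → Geodesic (cocktail-metric (2 + k))
cocktail-geodesic k u v n e with relation u v
  where open Cocktail (2 + k)
... | inj₁ refl = ⊥-elim (0≢1+n (trans (sym (Cocktail.cocktailδ-refl (2 + k) u)) e))
... | inj₂ (inj₂ ne) = v , different {u} {v} ne , trans (cocktailδ-refl v) (suc-injective (trans (sym (different {u} {v} ne)) e))
  where open Cocktail (2 + k)
... | inj₂ (inj₁ refl) = other v , adjacent v , trans (adjacent' v) (suc-injective (trans (sym (δ-antipode v)) e))
  where
  open Cocktail (2 + k)
  other : P → P
  other (zero , _)  = suc zero , false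
  other (suc _ , _) = zero , false
  adjacent : ∀ v → cocktailδ (antipode v) (other v) ≡ 1
  adjacent (zero , _)  = refl
  adjacent (suc _ , _) = refl
  adjacent' : ∀ v → cocktailδ (other v) v ≡ 1
  adjacent' (zero , _)  = refl
  adjacent' (suc _ , _) = refl

Local-cocktail : ∀ k → Local (cocktail-metric (suc k)) (zero , false) ≃ cocktail-metric k
Local-cocktail k = record
  { to      = λ { ((suc i , p) , _) → i , p ; ((zero , false) , ()) ; ((zero , true) , ()) }
  ; from    = λ { (i , p) → (suc i , p) , refl }
  ; isom    = λ { ((suc i , p) , _) ((suc j , q) , _) → refl
                ; ((zero , false) , ()) _ ; ((zero , true) , ()) _
                ; _ ((zero , false) , ()) ; _ ((zero , true) , ()) }
  ; to-from = λ _ → refl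
  }

-- The four-cycle is both a grid and a cocktail party graph; this coincidence later identifies
-- J(4,2) with CP(3).
square : johnson-metric 2 1 ⊗ johnson-metric 2 1 ≃ cocktail-metric 2
square = record { to = into ; from = out ; isom = isom-into ; to-from = into-out }
  where
  Square = V (Johnson 2 1) × V (Johnson 2 1)
  pattern ft = (false ∷ true ∷ []) , refl
  pattern tf = (true ∷ false ∷ []) , refl
  into : Square → V (CocktailParty 2)
  into (ft , ft) = zero , false
  into (tf , tf) = zero , true
  into (ft , tf) = suc zero , false
  into (tf , ft) = suc zero , true
  out : V (CocktailParty 2) → Square
  out (zero , false)     = ft , ft
  out (zero , true)      = tf , tf
  out (suc zero , false) = ft , tf
  out (suc zero , true)  = tf , ft
  isom-into : ∀ u v → δ (cocktail-metric 2) (into u) (into v) ≡ δ (johnson-metric 2 1 ⊗ johnson-metric 2 1) u v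
  isom-into (ft , ft) (ft , ft) = refl
  isom-into (ft , ft) (tf , tf) = refl
  isom-into (ft , ft) (ft , tf) = refl
  isom-into (ft , ft) (tf , ft) = refl
  isom-into (tf , tf) (ft , ft) = refl
  isom-into (tf , tf) (tf , tf) = refl
  isom-into (tf , tf) (ft , tf) = refl
  isom-into (tf , tf) (tf , ft) = refl
  isom-into (ft , tf) (ft , ft) = refl
  isom-into (ft , tf) (tf , tf) = refl
  isom-into (ft , tf) (ft , tf) = refl
  isom-into (ft , tf) (tf , ft) = refl
  isom-into (tf , ft) (ft , ft) = refl
  isom-into (tf , ft) (tf , tf) = refl
  isom-into (tf , ft) (ft , tf) = refl
  isom-into (tf , ft) (tf , ft) = refl
  into-out : ∀ u → into (out u) ≡ u
  into-out (zero , false)     = refl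
  into-out (zero , true)      = refl
  into-out (suc zero , false) = refl
  into-out (suc zero , true)  = refl

-- The Gosset graph

drop-common : ∀ {n m} (s t : Vec Bool n) → ∣ s ∩ t ∣ ≡ suc m →
              ∃[ w ] (suc ∣ w ∣ ≡ ∣ s ∣ × hdist s w ≡ 1 × hdist w t ≡ suc (hdist s t))
drop-common []          []          ()
drop-common (true ∷ s)  (true ∷ t)  e = false ∷ s , refl , cong suc (hdist-refl s) , refl
drop-common (true ∷ s)  (false ∷ t) e = let w , p , q , r = drop-common s t e in true ∷ w , cong suc p , q , cong suc r
drop-common (false ∷ s) (true ∷ t)  e = let w , p , q , r = drop-common s t e in false ∷ w , p , q , cong suc r
drop-common (false ∷ s) (false ∷ t) e = let w , p , q , r = drop-common s t e in false ∷ w , p , q , r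

hdist-∁ʳ : ∀ {n} (s t : Vec Bool n) → hdist s (∁ t) + hdist s t ≡ n
hdist-∁ʳ []          []          = refl
hdist-∁ʳ (false ∷ s) (false ∷ t) = cong suc (hdist-∁ʳ s t)
hdist-∁ʳ (true ∷ s)  (true ∷ t)  = cong suc (hdist-∁ʳ s t)
hdist-∁ʳ (false ∷ s) (true ∷ t)  = trans (+-suc _ _) (cong suc (hdist-∁ʳ s t))
hdist-∁ʳ (true ∷ s)  (false ∷ t) = trans (+-suc _ _) (cong suc (hdist-∁ʳ s t))

remaining : ∀ {n} → Vec Bool n → Vec Bool n → Vec Bool n → Vec Bool n
remaining x y u = ∁ (x ∪ (y ∪ u))

-- The four sets partition the points, so at each place exactly one of the four words has a one: the
-- place contributes one if `v` has a zero there and three otherwise.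
partition-sum : ∀ {n} (x y u v : Vec Bool n) → ∣ x ∩ y ∣ ≡ 0 → ∣ u ∩ x ∣ ≡ 0 → ∣ u ∩ y ∣ ≡ 0 →
  hdist (remaining x y u) v + hdist x v + (hdist u v + hdist y v) ≡ n + (∣ v ∣ + ∣ v ∣)
partition-sum []      []      []      []      _ _ _ = refl
partition-sum {suc n} (p ∷ x) (q ∷ y) (r ∷ u) (s ∷ v) e f g = bits p q r s e f g
  where
  column : ∀ b₁ b₂ b₃ b₄ k → b₁ + b₂ + (b₃ + b₄) ≡ suc (k + k) →
           ∣ x ∩ y ∣ ≡ 0 → ∣ u ∩ x ∣ ≡ 0 → ∣ u ∩ y ∣ ≡ 0 →
           (b₁ + hdist (remaining x y u) v) + (b₂ + hdist x v) + ((b₃ + hdist u v) + (b₄ + hdist y v))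
           ≡ suc n + ((k + ∣ v ∣) + (k + ∣ v ∣))
  column b₁ b₂ b₃ b₄ k p e f g =
    trans (split b₁ b₂ b₃ b₄ (hdist (remaining x y u) v) (hdist x v) (hdist u v) (hdist y v))
      (trans (cong₂ _+_ p (partition-sum x y u v e f g)) (join k n ∣ v ∣))
    where
    split : ∀ b₁ b₂ b₃ b₄ h₁ h₂ h₃ h₄ → (b₁ + h₁) + (b₂ + h₂) + ((b₃ + h₃) + (b₄ + h₄))
          ≡ b₁ + b₂ + (b₃ + b₄) + (h₁ + h₂ + (h₃ + h₄))
    split = solve-∀
    join : ∀ k n m → suc (k + k) + (n + (m + m)) ≡ suc n + ((k + m) + (k + m))
    join = solve-∀
  bits : ∀ p q r s → ∣ (p ∷ x) ∩ (q ∷ y) ∣ ≡ 0 → ∣ (r ∷ u) ∩ (p ∷ x) ∣ ≡ 0 → ∣ (r ∷ u) ∩ (q ∷ y) ∣ ≡ 0 →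
         hdist (remaining (p ∷ x) (q ∷ y) (r ∷ u)) (s ∷ v) + hdist (p ∷ x) (s ∷ v)
         + (hdist (r ∷ u) (s ∷ v) + hdist (q ∷ y) (s ∷ v)) ≡ suc n + (∣ s ∷ v ∣ + ∣ s ∷ v ∣)
  bits false false false false e f g = column 1 0 0 0 0 refl e f g
  bits false false false true  e f g = column 0 1 1 1 1 refl e f g
  bits true  false false false e f g = column 0 1 0 0 0 refl e f g
  bits true  false false true  e f g = column 1 0 1 1 1 refl e f g
  bits false true  false false e f g = column 0 0 0 1 0 refl e f g
  bits false true  false true  e f g = column 1 1 1 0 1 refl e f g
  bits false false true  false e f g = column 0 0 1 0 0 refl e f g
  bits false false true  true  e f g = column 1 1 0 1 1 refl e f g
  bits true  true  _     _     () _ _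
  bits true  false true  _     _ () _
  bits false true  true  _     _ _ ()

Pair : Set
Pair = V (Johnson 8 2)

pairδ : Pair → Pair → ℕ
pairδ = δ (johnson-metric 8 2)

pairδ-double : ∀ s t → pairδ s t + pairδ s t ≡ hdist (proj₁ s) (proj₁ t)
pairδ-double = Code.half+half (johnsonCode 8 2)

pairδ-∩ : ∀ s t → pairδ s t + ∣ proj₁ s ∩ proj₁ t ∣ ≡ 2
pairδ-∩ s t = double-injective (trans (interchange (pairδ s t) ∣ proj₁ s ∩ proj₁ t ∣)
  (trans (cong (_+ (∣ proj₁ s ∩ proj₁ t ∣ + ∣ proj₁ s ∩ proj₁ t ∣)) (pairδ-double s t))
    (trans (hdist-∩ (proj₁ s) (proj₁ t)) (cong₂ _+_ (proj₂ s) (proj₂ t)))))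

pairδ-≤2 : ∀ s t → pairδ s t ≤ 2
pairδ-≤2 s t = ≤-trans (m≤m+n (pairδ s t) ∣ proj₁ s ∩ proj₁ t ∣) (≤-reflexive (pairδ-∩ s t))

-- The Gosset graph is antipodal of diameter three: replacing a vertex by its antipode, the same
-- pair in the other copy, turns a distance `d` into `3 − d`.
oppositeδ : Pair → Pair → ℕ
oppositeδ s t = 3 ∸ pairδ s t

opposite-sum : ∀ s t → oppositeδ s t + pairδ s t ≡ 3
opposite-sum s t = m∸n+n≡m (m≤n⇒m≤1+n (pairδ-≤2 s t))

-- Effect of antipodes on a parallelogram equation: all four vertices may be replaced, or one on
-- each side after an exchange of the other two; if the four distances sum to six, two are replaced.
module Complement (p q r s v : Pair) where
  private
    p⁺ = opposite-sum p v
    q⁺ = opposite-sum q v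
    r⁺ = opposite-sum r v
    s⁺ = opposite-sum s v

  flip-all : pairδ p v + pairδ q v ≡ pairδ r v + pairδ s v →
             oppositeδ p v + oppositeδ q v ≡ oppositeδ r v + oppositeδ s v
  flip-all e = modulo (cong₂ _+_ (cong₂ _+_ p⁺ q⁺) (cong₂ _+_ (sym (cong₂ _+_ r⁺ s⁺)) (sym e)))
    (rearrange (pairδ p v) (pairδ q v) (pairδ r v) (pairδ s v)
               (oppositeδ p v) (oppositeδ q v) (oppositeδ r v) (oppositeδ s v))
    where
    rearrange : ∀ p q r s p' q' r' s' →
      p' + q' + (6 + (r' + r + (s' + s) + (p + q))) ≡ r' + s' + (p' + p + (q' + q) + (6 + (r + s)))
    rearrange = solve-∀

  flip-pr : pairδ p v + pairδ q v ≡ pairδ r v + pairδ s v →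
            oppositeδ p v + pairδ s v ≡ oppositeδ r v + pairδ q v
  flip-pr e = modulo (cong₂ _+_ p⁺ (cong₂ _+_ (sym r⁺) (sym e)))
    (rearrange (pairδ p v) (pairδ q v) (pairδ r v) (pairδ s v) (oppositeδ p v) (oppositeδ r v))
    where
    rearrange : ∀ p q r s p' r' → p' + s + (3 + (r' + r + (p + q))) ≡ r' + q + (p' + p + (3 + (r + s)))
    rearrange = solve-∀

  flip-rs : pairδ p v + pairδ q v + (pairδ r v + pairδ s v) ≡ 6 →
            pairδ p v + pairδ q v ≡ oppositeδ r v + oppositeδ s v
  flip-rs e = modulo (cong₂ _+_ e (sym (cong₂ _+_ r⁺ s⁺)))
    (rearrange (pairδ p v) (pairδ q v) (pairδ r v) (pairδ s v) (oppositeδ r v) (oppositeδ s v))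
    where
    rearrange : ∀ p q r s r' s' → p + q + (6 + (r' + r + (s' + s))) ≡ r' + s' + (p + q + (r + s) + 6)
    rearrange = solve-∀

  flip-pq : pairδ p v + pairδ q v + (pairδ r v + pairδ s v) ≡ 6 →
            oppositeδ p v + oppositeδ q v ≡ pairδ r v + pairδ s v
  flip-pq e = modulo (cong₂ _+_ (cong₂ _+_ p⁺ q⁺) (sym e))
    (rearrange (pairδ p v) (pairδ q v) (pairδ r v) (pairδ s v) (oppositeδ p v) (oppositeδ q v))
    where
    rearrange : ∀ p q r s p' q' → p' + q' + (6 + (p + q + (r + s))) ≡ r + s + (p' + p + (q' + q) + 6)
    rearrange = solve-∀
open Complement

gossetδ : V Gosset → V Gosset → ℕ
gossetδ (s , false) (t , false) = pairδ s t
gossetδ (s , true)  (t , true)  = pairδ s t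
gossetδ (s , false) (t , true)  = oppositeδ s t
gossetδ (s , true)  (t , false) = oppositeδ s t

oppositeδ-positive : ∀ {s t} → ¬ oppositeδ s t ≡ 0
oppositeδ-positive {s} {t} e = 1+n≰n (subst (_≤ 2) (trans (cong (_+ pairδ s t) (sym e)) (opposite-sum s t))
  (pairδ-≤2 s t))

oppositeδ-sym : ∀ s t → oppositeδ s t ≡ oppositeδ t s
oppositeδ-sym s t = cong (3 ∸_) (δ-sym (johnson-metric 8 2) s t)

module _ where
  private
    J = johnson-metric 8 2

    -- This and the next three are the cases of `para` up to exchanging the copies, named after the
    -- vertices outside the copy of `x`. The two equations are for `v` in the copy of `x` and in the
    -- other copy.
    same-signs : ∀ {x y u} → pairδ x y ≡ 1 → pairδ u y ≡ suc (pairδ u x) →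
      ∃[ u' ] ∀ v → (pairδ u' v + pairδ x v ≡ pairδ u v + pairδ y v)
                  × (oppositeδ u' v + oppositeδ x v ≡ oppositeδ u v + oppositeδ y v)
    same-signs {x} {y} {u} e k = let u' , eq = para J {x} {y} {u} e k in u' , λ v → eq v ,
      flip-all u' x u y v (eq v)

    u-opposite : ∀ {x y u} → pairδ x y ≡ 1 → oppositeδ u y ≡ suc (oppositeδ u x) →
      ∃[ u' ] ∀ v → (oppositeδ u' v + pairδ x v ≡ oppositeδ u v + pairδ y v)
                  × (pairδ u' v + oppositeδ x v ≡ pairδ u v + oppositeδ y v)
    u-opposite {x} {y} {u} e k =
      let u' , eq = para J {y} {x} {u} (trans (δ-sym J y x) e) ux in
      u' , λ v →
        flip-pr u' y u x v (eq v) ,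
        trans (+-comm (pairδ u' v) _) (trans (sym (flip-pr y u' x u v
            (trans (+-comm (pairδ y v) _) (trans (eq v) (+-comm (pairδ u v) _))))) (+-comm _ (pairδ u v)))
      where
      ux : pairδ u x ≡ suc (pairδ u y)
      ux = +-cancelˡ-≡ (oppositeδ u x) _ _ (trans (opposite-sum u x) (trans (sym (opposite-sum u y))
        (trans (cong (_+ pairδ u y) k) (sym (+-suc _ _)))))

    -- As pairs, `x` and `y` are disjoint and `u` lies in their union; `u'` is the rest of this
    -- union.
    y-opposite : ∀ {x y u} → oppositeδ x y ≡ 1 → oppositeδ u y ≡ suc (pairδ u x) →
      ∃[ u' ] ∀ v → (oppositeδ u' v + pairδ x v ≡ pairδ u v + oppositeδ y v)
                  × (pairδ u' v + oppositeδ x v ≡ oppositeδ u v + pairδ y v)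
    y-opposite {x} {y} {u} e k = u' , λ v →
        trans (flip-pr u' u y x v
          (trans (eq v) (+-comm (pairδ x v) _))) (+-comm _ (pairδ u v)) ,
        trans (+-comm (pairδ u' v) _) (flip-pr x y u u' v (trans (sym (eq v)) (+-comm (pairδ u' v) _)))
      where
      xy : pairδ x y ≡ 2
      xy = suc-injective (trans (cong (_+ pairδ x y) (sym e)) (opposite-sum x y))
      between : pairδ x u + pairδ u y ≡ 2
      between = suc-injective (trans (cong (λ n → suc (n + pairδ u y)) (δ-sym J x u))
        (trans (cong (_+ pairδ u y) (sym k)) (opposite-sum u y)))
      line : hdist (proj₁ x) (proj₁ y) ≡ hdist (proj₁ x) (proj₁ u) + hdist (proj₁ u) (proj₁ y)
      line = trans (sym (pairδ-double x y)) (trans (cong₂ _+_ (trans xy (sym between)) (trans xy (sym between)))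
        (trans (interchange (pairδ x u) (pairδ u y)) (cong₂ _+_ (pairδ-double x u) (pairδ-double u y))))
      u'-parallel : ∀ v → hdist (move (proj₁ u) (proj₁ y) (proj₁ x)) v + hdist (proj₁ u) v
                        ≡ hdist (proj₁ x) v + hdist (proj₁ y) v
      u'-parallel v = move-parallel (proj₁ u) (proj₁ y) (proj₁ x) v line
      u' : Pair
      u' = move (proj₁ u) (proj₁ y) (proj₁ x) ,
        Code.closed (johnsonCode 8 2) {proj₁ u} {proj₁ y} {proj₁ x} {move (proj₁ u) (proj₁ y) (proj₁ x)} (proj₂ u) (proj₂ y) (proj₂ x) u'-parallel
      eq : ∀ v → pairδ u' v + pairδ u v ≡ pairδ x v + pairδ y v
      eq v = double-injective (trans (interchange (pairδ u' v) (pairδ u v))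
        (trans (cong₂ _+_ (pairδ-double u' v) (pairδ-double u v)) (trans (u'-parallel (proj₁ v))
          (trans (sym (cong₂ _+_ (pairδ-double x v) (pairδ-double y v))) (sym (interchange (pairδ x v) (pairδ y v)))))))

    -- Here x, y and u are disjoint pairs, and u' consists of the two points they leave.
    yu-opposite : ∀ {x y u} → oppositeδ x y ≡ 1 → pairδ u y ≡ suc (oppositeδ u x) →
      ∃[ u' ] ∀ v → (pairδ u' v + pairδ x v ≡ oppositeδ u v + oppositeδ y v)
                  × (oppositeδ u' v + oppositeδ x v ≡ pairδ u v + pairδ y v)
    yu-opposite {x} {y} {u} e k = u' , λ v →
        flip-rs u' x u y v (eq v) ,
        flip-pq u' x u y v (eq v)
      where
      xy : pairδ x y ≡ 2
      xy = suc-injective (trans (cong (_+ pairδ x y) (sym e)) (opposite-sum x y))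
      ux′ : oppositeδ u x ≡ 1
      ux′ = one (oppositeδ u x) (λ z → oppositeδ-positive {u} {x} z) (≤-pred (≤-trans (≤-reflexive (sym k)) (pairδ-≤2 u y)))
        where
        one : ∀ n → ¬ n ≡ 0 → n ≤ 1 → n ≡ 1
        one zero          ¬z _ = ⊥-elim (¬z refl)
        one (suc zero)    ¬z _ = refl
        one (suc (suc _)) ¬z (s≤s ())
      ux : pairδ u x ≡ 2
      ux = suc-injective (trans (cong (_+ pairδ u x) (sym ux′)) (opposite-sum u x))
      uy : pairδ u y ≡ 2
      uy = trans k (cong suc ux′)
      disjoint : ∀ s t → pairδ s t ≡ 2 → ∣ proj₁ s ∩ proj₁ t ∣ ≡ 0
      disjoint s t f = +-cancelˡ-≡ 2 _ 0 (trans (cong (_+ ∣ proj₁ s ∩ proj₁ t ∣) (sym f)) (pairδ-∩ s t))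
      w : Vec Bool 8
      w = remaining (proj₁ x) (proj₁ y) (proj₁ u)
      sum : ∀ v → hdist w v + hdist (proj₁ x) v + (hdist (proj₁ u) v + hdist (proj₁ y) v) ≡ 8 + (∣ v ∣ + ∣ v ∣)
      sum v = partition-sum (proj₁ x) (proj₁ y) (proj₁ u) v (disjoint x y xy) (disjoint u x ux) (disjoint u y uy)
      u' : Pair
      u' = w , +-cancelʳ-≡ 6 ∣ w ∣ 2 (trans (sym (+-assoc ∣ w ∣ 2 4)) (trans (cong₂ _+_
          (cong₂ _+_ (weight w) (trans (sym (proj₂ x)) (weight (proj₁ x))))
          (cong₂ _+_ (trans (sym (proj₂ u)) (weight (proj₁ u))) (trans (sym (proj₂ y)) (weight (proj₁ y)))))
        (sum Subset.⊥)))
        where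
        weight : ∀ (s : Vec Bool 8) → ∣ s ∣ ≡ hdist s Subset.⊥
        weight s = trans (sym (hdist-⊥ s)) (hdist-sym _ s)
      eq : ∀ v → pairδ u' v + pairδ x v + (pairδ u v + pairδ y v) ≡ 6
      eq v = double-injective (trans (interchange₄ (pairδ u' v) (pairδ x v) (pairδ u v) (pairδ y v))
        (trans (cong₂ _+_ (cong₂ _+_ (pairδ-double u' v) (pairδ-double x v))
                          (cong₂ _+_ (pairδ-double u v) (pairδ-double y v)))
          (trans (sum (proj₁ v)) (cong (λ n → 8 + (n + n)) (proj₂ v)))))
        where
        interchange₄ : ∀ p q r s → p + q + (r + s) + (p + q + (r + s)) ≡ p + p + (q + q) + (r + r + (s + s))
        interchange₄ = solve-∀

    lip-≤ : ∀ m n m' n' → m' + m ≡ 3 → n' + n ≡ 3 → m ≤ suc n → n' ≤ suc m'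
    lip-≤ m n m' n' p q l = +-cancelʳ-≤ n n' (suc m') (≤-trans (≤-reflexive (trans q (sym p)))
      (≤-trans (+-monoʳ-≤ m' l) (≤-reflexive (+-suc m' n))))

    lip-opposite : ∀ {x y} u → oppositeδ x y ≡ 1 → oppositeδ u y ≤ suc (pairδ u x)
    lip-opposite {x} {y} u e = +-cancelʳ-≤ (pairδ u y) _ _ (≤-trans (≤-reflexive (opposite-sum u y)) (s≤s
      (subst₂ _≤_ xy (cong (_+ pairδ u y) (δ-sym J x u))
        (⌊n/2⌋-mono′ (pairδ x u) (pairδ u y) (≤-trans (hdist-triangle (proj₁ x) (proj₁ u) (proj₁ y))
          (≤-reflexive (sym (cong₂ _+_ (pairδ-double x u) (pairδ-double u y)))))))))
      where
      xy : pairδ x y ≡ 2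
      xy = suc-injective (trans (cong (_+ pairδ x y) (sym e)) (opposite-sum x y))
      ⌊n/2⌋-mono′ : ∀ {h} m n → h ≤ (m + m) + (n + n) → ⌊ h /2⌋ ≤ m + n
      ⌊n/2⌋-mono′ m n l = ≤-trans (⌊n/2⌋-mono (≤-trans l (≤-reflexive (sym (interchange m n)))))
        (≤-reflexive (sym (n≡⌊n+n/2⌋ (m + n))))

    lip-opposite′ : ∀ {x y} u → oppositeδ x y ≡ 1 → pairδ u y ≤ suc (oppositeδ u x)
    lip-opposite′ {x} {y} u e = ≤-trans (pairδ-≤2 u y) (s≤s (n≢0⇒n>0 (oppositeδ-positive {u} {x})))

  gosset-metric : ParMetric (V Gosset)
  gosset-metric = record
    { δ      = gossetδ
    ; δ-refl = λ { (s , false) → δ-refl J s ; (s , true) → δ-refl J s }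
    ; δ-zero = λ { {s , false} {t , false} e → cong (_, false) (δ-zero J e)
                 ; {s , true}  {t , true}  e → cong (_, true) (δ-zero J e)
                 ; {s , false} {t , true}  e → ⊥-elim (oppositeδ-positive {s} {t} e)
                 ; {s , true}  {t , false} e → ⊥-elim (oppositeδ-positive {s} {t} e) }
    ; δ-sym  = λ { (s , false) (t , false) → δ-sym J s t
                 ; (s , true)  (t , true)  → δ-sym J s t
                 ; (s , false) (t , true)  → oppositeδ-sym s t
                 ; (s , true)  (t , false) → oppositeδ-sym s t }
    ; δ-lip  = λ {x} {y} → lip {x} {y}
    ; para   = λ {x} {y} {u} → par {x} {y} {u}
    }
    where
    lip : ∀ {x y} u → gossetδ x y ≡ 1 → gossetδ u y ≤ suc (gossetδ u x)
    lip {x , false} {y , false} (u , false) e = δ-lip J {x} {y} u e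
    lip {x , true}  {y , true}  (u , true)  e = δ-lip J {x} {y} u e
    lip {x , false} {y , false} (u , true)  e = lip-≤ (pairδ u x) (pairδ u y) (oppositeδ u x) (oppositeδ u y) (opposite-sum u x) (opposite-sum u y) (δ-lip J {y} {x} u (trans (δ-sym J y x) e))
    lip {x , true}  {y , true}  (u , false) e = lip-≤ (pairδ u x) (pairδ u y) (oppositeδ u x) (oppositeδ u y) (opposite-sum u x) (opposite-sum u y) (δ-lip J {y} {x} u (trans (δ-sym J y x) e))
    lip {x , false} {y , true}  (u , false) e = lip-opposite {x} {y} u e
    lip {x , true}  {y , false} (u , true)  e = lip-opposite {x} {y} u e
    lip {x , false} {y , true}  (u , true)  e = lip-opposite′ {x} {y} u e
    lip {x , true}  {y , false} (u , false) e = lip-opposite′ {x} {y} u e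
    par : ∀ {x y u} → gossetδ x y ≡ 1 → gossetδ u y ≡ suc (gossetδ u x) →
          ∃[ u' ] ∀ v → gossetδ u' v + gossetδ x v ≡ gossetδ u v + gossetδ y v
    par {x , false} {y , false} {u , false} e k = let u' , f = same-signs {x} {y} {u} e k in
      (u' , false) , λ { (v , false) → proj₁ (f v) ; (v , true) → proj₂ (f v) }
    par {x , true} {y , true} {u , true} e k = let u' , f = same-signs {x} {y} {u} e k in
      (u' , true) , λ { (v , true) → proj₁ (f v) ; (v , false) → proj₂ (f v) }
    par {x , false} {y , false} {u , true} e k = let u' , f = u-opposite {x} {y} {u} e k in
      (u' , true) , λ { (v , false) → proj₁ (f v) ; (v , true) → proj₂ (f v) }
    par {x , true} {y , true} {u , false} e k = let u' , f = u-opposite {x} {y} {u} e k in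
      (u' , false) , λ { (v , true) → proj₁ (f v) ; (v , false) → proj₂ (f v) }
    par {x , false} {y , true} {u , false} e k = let u' , f = y-opposite {x} {y} {u} e k in
      (u' , true) , λ { (v , false) → proj₁ (f v) ; (v , true) → proj₂ (f v) }
    par {x , true} {y , false} {u , true} e k = let u' , f = y-opposite {x} {y} {u} e k in
      (u' , false) , λ { (v , true) → proj₁ (f v) ; (v , false) → proj₂ (f v) }
    par {x , false} {y , true} {u , true} e k = let u' , f = yu-opposite {x} {y} {u} e k in
      (u' , false) , λ { (v , false) → proj₁ (f v) ; (v , true) → proj₂ (f v) }
    par {x , true} {y , false} {u , false} e k = let u' , f = yu-opposite {x} {y} {u} e k in
      (u' , true) , λ { (v , true) → proj₁ (f v) ; (v , false) → proj₂ (f v) }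

-- Between the two copies of the Gosset graph, nearer means fewer common points. So a common point
-- is dropped and replaced by one outside `t`.
away : ∀ {n m} (s t : Vec Bool n) → ∣ s ∩ t ∣ ≡ suc m → ∣ s ∣ ≤ ∣ ∁ t ∣ →
       ∃[ w ] (∣ w ∣ ≡ ∣ s ∣ × hdist s w ≡ 2 × hdist w t ≡ 2 + hdist s t)
away s t e l = w , weight , ≤-antisym near far , wt
  where
  first = drop-common s t e
  r = proj₁ first
  second = add r (∁ t) (≤-trans (≤-reflexive (proj₁ (proj₂ first))) l)
  w = proj₁ second
  weight : ∣ w ∣ ≡ ∣ s ∣
  weight = trans (proj₁ (proj₂ second)) (proj₁ (proj₂ first))
  wt : hdist w t ≡ 2 + hdist s t
  wt = trans (+-cancelˡ-≡ (hdist w (∁ t)) (hdist w t) (suc (hdist r t))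
      (trans (hdist-∁ʳ w t) (trans (sym (hdist-∁ʳ r t))
        (trans (cong (_+ hdist r t) (proj₂ (proj₂ (proj₂ second)))) (sym (+-suc _ _))))))
    (cong suc (proj₂ (proj₂ (proj₂ first))))
  near : hdist s w ≤ 2
  near = ≤-trans (hdist-triangle s r w)
    (≤-reflexive (cong₂ _+_ (proj₁ (proj₂ (proj₂ first))) (proj₁ (proj₂ (proj₂ second)))))
  far : 2 ≤ hdist s w
  far = +-cancelʳ-≤ (hdist s t) 2 _ (≤-trans (≤-reflexive (sym wt))
    (≤-trans (hdist-triangle w s t) (≤-reflexive (cong (_+ hdist s t) (hdist-sym w s)))))

away-pair : ∀ (s t : Pair) {n} → oppositeδ s t ≡ suc (suc n) →
            ∃[ w ] (pairδ s w ≡ 1 × oppositeδ w t ≡ suc n)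
away-pair s t {n} e = w , cong ⌊_/2⌋ sw , suc-injective (+-cancelʳ-≡ (pairδ s t) _ _
    (trans (trans (sym (+-suc (oppositeδ w t) (pairδ s t)))
      (trans (cong (oppositeδ w t +_) (sym (cong ⌊_/2⌋ wt))) (opposite-sum w t)))
      (trans (sym (opposite-sum s t)) (cong (_+ pairδ s t) e))))
  where
  meet : ∣ proj₁ s ∩ proj₁ t ∣ ≡ suc n
  meet = +-cancelˡ-≡ (pairδ s t) _ _ (suc-injective (trans (cong suc (pairδ-∩ s t))
    (trans (sym (opposite-sum s t)) (trans (+-comm _ (pairδ s t)) (trans (cong (pairδ s t +_) e) (+-suc _ _))))))
  ∁t : ∣ ∁ (proj₁ t) ∣ ≡ 6
  ∁t = +-cancelʳ-≡ 2 ∣ ∁ (proj₁ t) ∣ 6 (trans (cong (∣ ∁ (proj₁ t) ∣ +_) (sym (proj₂ t))) (∣∁∣ (proj₁ t)))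
  new = away (proj₁ s) (proj₁ t) meet (subst₂ _≤_ (sym (proj₂ s)) (sym ∁t) (s≤s (s≤s z≤n)))
  w : Pair
  w = proj₁ new , trans (proj₁ (proj₂ new)) (proj₂ s)
  sw : hdist (proj₁ s) (proj₁ w) ≡ 2
  sw = proj₁ (proj₂ (proj₂ new))
  wt : hdist (proj₁ w) (proj₁ t) ≡ 2 + hdist (proj₁ s) (proj₁ t)
  wt = proj₂ (proj₂ (proj₂ new))

gosset-geodesic : Geodesic gosset-metric
gosset-geodesic (s , false) (t , false) n e = let w , f , g = johnson-geodesic 8 2 s t n e in (w , false) , f , g
gosset-geodesic (s , true)  (t , true)  n e = let w , f , g = johnson-geodesic 8 2 s t n e in (w , true) , f , g
gosset-geodesic (s , false) (t , true)  zero    e = (t , true) , e , δ-refl (johnson-metric 8 2) t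
gosset-geodesic (s , true)  (t , false) zero    e = (t , false) , e , δ-refl (johnson-metric 8 2) t
gosset-geodesic (s , false) (t , true)  (suc n) e = let w , f , g = away-pair s t e in (w , false) , f , g
gosset-geodesic (s , true)  (t , false) (suc n) e = let w , f , g = away-pair s t e in (w , true) , f , g

pairδ-disjoint : ∀ s t → ∣ proj₁ s ∩ proj₁ t ∣ ≡ 0 ⇔ oppositeδ s t ≡ 1
pairδ-disjoint s t = mk⇔
  (λ e → cong (3 ∸_) (trans (sym (+-identityʳ (pairδ s t))) (trans (cong (pairδ s t +_) (sym e)) (pairδ-∩ s t))))
  (λ e → +-cancelˡ-≡ (pairδ s t) _ _ (trans (pairδ-∩ s t) (sym (trans (+-identityʳ _)
    (suc-injective (trans (cong (_+ pairδ s t) (sym e)) (opposite-sum s t)))))))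

gosset-edge : ∀ u v → E Gosset u v ⇔ gossetδ u v ≡ 1
gosset-edge u v = mk⇔ (forth u v) (back u v)
  where
  meet⇔ : ∀ s t → E (Johnson 8 2) s t ⇔ pairδ s t ≡ 1
  meet⇔ s t = johnson-edge s t
  forth : ∀ u v → E Gosset u v → gossetδ u v ≡ 1
  forth (s , false) (t , false) (inj₁ (_ , e)) = Equivalence.to (meet⇔ s t) (cong suc e)
  forth (s , true)  (t , true)  (inj₁ (_ , e)) = Equivalence.to (meet⇔ s t) (cong suc e)
  forth (s , false) (t , true)  (inj₁ (() , _))
  forth (s , true)  (t , false) (inj₁ (() , _))
  forth (s , false) (t , false) (inj₂ (ne , _)) = ⊥-elim (ne refl)
  forth (s , true)  (t , true)  (inj₂ (ne , _)) = ⊥-elim (ne refl)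
  forth (s , false) (t , true)  (inj₂ (_ , e)) = Equivalence.to (pairδ-disjoint s t) e
  forth (s , true)  (t , false) (inj₂ (_ , e)) = Equivalence.to (pairδ-disjoint s t) e
  back : ∀ u v → gossetδ u v ≡ 1 → E Gosset u v
  back (s , false) (t , false) e = inj₁ (refl , suc-injective (Equivalence.from (meet⇔ s t) e))
  back (s , true)  (t , true)  e = inj₁ (refl , suc-injective (Equivalence.from (meet⇔ s t) e))
  back (s , false) (t , true)  e = inj₂ ((λ ()) , Equivalence.from (pairδ-disjoint s t) e)
  back (s , true)  (t , false) e = inj₂ ((λ ()) , Equivalence.from (pairδ-disjoint s t) e)

-- The Schläfli graph

-- Lets the Schläfli graph take its parallelograms from the local metric of the Gosset graph.
module Pullback {A B : Set} (M : ParMetric A) (f : B → A) (g : A → B) (fg : ∀ u → f (g u) ≡ u)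
                (injective : ∀ {u v} → f u ≡ f v → u ≡ v) where
  metric : ParMetric B
  metric = record
    { δ      = λ u v → δ M (f u) (f v)
    ; δ-refl = λ u → δ-refl M (f u)
    ; δ-zero = λ e → injective (δ-zero M e)
    ; δ-sym  = λ u v → δ-sym M (f u) (f v)
    ; δ-lip  = λ u → δ-lip M (f u)
    ; para   = λ {x} {y} {u} e k → let u' , eq = para M e k in
        g u' , λ v → trans (cong (λ w → δ M w (f v) + δ M (f x) (f v)) (fg u')) (eq (f v))
    }

  equivalence : metric ≃ M
  equivalence = record { to = f ; from = g ; isom = λ _ _ → refl ; to-from = fg }

gosset-origin : V Gosset
gosset-origin = (Subset.⊤ {2} ++ Subset.⊥ {6} , refl) , false

weight-zero : ∀ {n} (s : Subset n) → ∣ s ∣ ≡ 0 → s ≡ Subset.⊥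
weight-zero []          e = refl
weight-zero (false ∷ s) e = cong (false ∷_) (weight-zero s e)

singleton : ∀ {n} (s : Subset n) → ∣ s ∣ ≡ 1 → ∃[ i ] ⁅ i ⁆ ≡ s
singleton (false ∷ s) e = let i , p = singleton s e in suc i , cong (false ∷_) p
singleton (true ∷ s)  e = zero , cong (true ∷_) (sym (weight-zero s (suc-injective e)))

doubleton : ∀ {n} (s : Subset n) → ∣ s ∣ ≡ 2 → ∃[ i ] ∃[ j ] (i Fin.< j × ⁅ i ⁆ ∪ ⁅ j ⁆ ≡ s)
doubleton (false ∷ s) e = let i , j , l , p = doubleton s e in suc i , suc j , s≤s l , cong (false ∷_) p
doubleton (true ∷ s)  e = let i , p = singleton s (suc-injective e) in
  zero , suc i , s≤s z≤n , cong (true ∷_) (trans (∪-identityˡ ⁅ i ⁆) p)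

∣⁅i⁆∪⁅j⁆∣ : ∀ {n} {i j : Fin n} → i Fin.< j → ∣ ⁅ i ⁆ ∪ ⁅ j ⁆ ∣ ≡ 2
∣⁅i⁆∪⁅j⁆∣ {i = zero}  {suc j} l = cong suc (trans (cong ∣_∣ (∪-identityˡ ⁅ j ⁆)) (∣⁅x⁆∣≡1 j))
∣⁅i⁆∪⁅j⁆∣ {i = suc i} {suc j} l = ∣⁅i⁆∪⁅j⁆∣ (≤-pred l)

Neighbour : Set
Neighbour = Σ (V Gosset) (λ u → gossetδ gosset-origin u ≡ 1)

-- The origin is the pair of the first two points. In its own copy its neighbours join one of these
-- to one of the other six points, which gives the double six; in the other copy they are the 15
-- pairs of the other six points.
lineVertex : Line → Neighbour
lineVertex (Defs.a i) = ((true ∷ false ∷ ⁅ i ⁆ , cong suc (∣⁅x⁆∣≡1 i)) , false) ,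
  cong (λ n → ⌊ suc n /2⌋) (trans (hdist-⊥ ⁅ i ⁆) (∣⁅x⁆∣≡1 i))
lineVertex (Defs.b i) = ((false ∷ true ∷ ⁅ i ⁆ , cong suc (∣⁅x⁆∣≡1 i)) , false) ,
  cong (λ n → ⌊ suc n /2⌋) (trans (hdist-⊥ ⁅ i ⁆) (∣⁅x⁆∣≡1 i))
lineVertex (Defs.c i j l) = ((false ∷ false ∷ (⁅ i ⁆ ∪ ⁅ j ⁆) , ∣⁅i⁆∪⁅j⁆∣ l) , true) ,
  cong (λ n → 3 ∸ ⌊ suc (suc n) /2⌋) (trans (hdist-⊥ (⁅ i ⁆ ∪ ⁅ j ⁆)) (∣⁅i⁆∪⁅j⁆∣ l))

vertexLine : ∀ u → ∃[ l ] lineVertex l ≡ u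
vertexLine (((p ∷ q ∷ s , e) , σ) , k) = locate p q σ e k
  where
  same-vertex : ∀ {l} {u : Neighbour} → proj₁ (proj₁ (proj₁ (lineVertex l))) ≡ proj₁ (proj₁ (proj₁ u)) →
                proj₂ (proj₁ (lineVertex l)) ≡ proj₂ (proj₁ u) → lineVertex l ≡ u
  same-vertex f g = Σ-≡ ≡-irrelevant (cong₂ _,_ (Σ-≡ ≡-irrelevant f) g)
  locate : ∀ p q σ (e : ∣ p ∷ q ∷ s ∣ ≡ 2) (k : gossetδ gosset-origin ((p ∷ q ∷ s , e) , σ) ≡ 1) →
         ∃[ l ] lineVertex l ≡ (((p ∷ q ∷ s , e) , σ) , k)
  locate true false false e k = let i , f = singleton s (suc-injective e) in
    Defs.a i , same-vertex {Defs.a i} (cong (λ t → true ∷ false ∷ t) f) refl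
  locate false true false e k = let i , f = singleton s (suc-injective e) in
    Defs.b i , same-vertex {Defs.b i} (cong (λ t → false ∷ true ∷ t) f) refl
  locate false false true e k = let i , j , l , f = doubleton s e in
    Defs.c i j l , same-vertex {Defs.c i j l} (cong (λ t → false ∷ false ∷ t) f) refl
  locate true true false e k =
    ⊥-elim (0≢1+n (trans (sym (cong ⌊_/2⌋ (trans (hdist-⊥ s) (suc-injective (suc-injective e))))) k))
  locate false false false e k =
    ⊥-elim (1+n≢n (trans (sym (cong (λ n → suc ⌊ n /2⌋) (trans (hdist-⊥ s) e))) k))
  locate true true true e k =
    ⊥-elim (2≢3 (suc-injective (trans (sym k) (cong (λ n → 3 ∸ ⌊ n /2⌋) (trans (hdist-⊥ s) (suc-injective (suc-injective e)))))))
    where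
    2≢3 : ¬ 0 ≡ 2
    2≢3 ()
  locate true false true e k =
    ⊥-elim (0≢1+n (suc-injective (trans (sym k) (cong (λ n → 3 ∸ ⌊ suc n /2⌋) (trans (hdist-⊥ s) (suc-injective e))))))
  locate false true true e k =
    ⊥-elim (0≢1+n (suc-injective (trans (sym k) (cong (λ n → 3 ∸ ⌊ suc n /2⌋) (trans (hdist-⊥ s) (suc-injective e))))))

-- The facts about the Schläfli graph are decided by running through its 27 lines; irrelevance of
-- `i < j` leaves one line for each such pair.
all-lines? : {P : Line → Set} → (∀ l → Dec (P l)) → Dec (∀ l → P l)
all-lines? {P} P? = map′
  (λ { (f , g , h) (Defs.a i) → f i ; (f , g , h) (Defs.b i) → g i ; (f , g , h) (Defs.c i j l) → h i j l })
  (λ f → (λ i → f (Defs.a i)) , (λ i → f (Defs.b i)) , λ i j l → f (Defs.c i j l))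
  (Fin.all? (λ i → P? (Defs.a i)) ×-dec Fin.all? (λ i → P? (Defs.b i)) ×-dec
   Fin.all? (λ i → Fin.all? (λ j → on-c i j)))
  where
  on-c : ∀ i j → Dec ((l : i Fin.< j) → P (Defs.c i j l))
  on-c i j with i Fin.<? j
  ... | yes l = map′ (λ p m → subst (λ l → P (Defs.c i j l)) (Fin.<-irrelevant l m) p) (λ f → f l) (P? (Defs.c i j l))
  ... | no ¬l = yes (λ l → ⊥-elim (¬l l))

any-line? : {P : Line → Set} → (∀ l → Dec (P l)) → Dec (∃ P)
any-line? {P} P? = map′
  (λ { (inj₁ (i , p)) → Defs.a i , p ; (inj₂ (inj₁ (i , p))) → Defs.b i , p
     ; (inj₂ (inj₂ (i , j , l , p))) → Defs.c i j l , p })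
  (λ { (Defs.a i , p) → inj₁ (i , p) ; (Defs.b i , p) → inj₂ (inj₁ (i , p))
     ; (Defs.c i j l , p) → inj₂ (inj₂ (i , j , l , p)) })
  (Fin.any? (λ i → P? (Defs.a i)) ⊎-dec Fin.any? (λ i → P? (Defs.b i)) ⊎-dec
   Fin.any? (λ i → Fin.any? (λ j → on-c i j)))
  where
  on-c : ∀ i j → Dec (∃ λ (l : i Fin.< j) → P (Defs.c i j l))
  on-c i j with i Fin.<? j
  ... | no ¬l = no (λ { (l , _) → ¬l l })
  ... | yes l = map′ (l ,_) (λ { (m , p) → subst (λ l → P (Defs.c i j l)) (Fin.<-irrelevant m l) p }) (P? (Defs.c i j l))

lineδ : Line → Line → ℕ
lineδ l m = gossetδ (proj₁ (lineVertex l)) (proj₁ (lineVertex m))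

line-≟ : (l m : Line) → Dec (l ≡ m)
line-≟ (Defs.a i) (Defs.a j) = map′ (cong Defs.a) (λ { refl → refl }) (i Fin.≟ j)
line-≟ (Defs.b i) (Defs.b j) = map′ (cong Defs.b) (λ { refl → refl }) (i Fin.≟ j)
line-≟ (Defs.c i j p) (Defs.c k l q) =
  map′ (λ { (refl , refl) → cong (Defs.c i j) (Fin.<-irrelevant p q) }) (λ { refl → refl , refl })
    (i Fin.≟ k ×-dec j Fin.≟ l)
line-≟ (Defs.a _)     (Defs.b _)     = no λ ()
line-≟ (Defs.a _)     (Defs.c _ _ _) = no λ ()
line-≟ (Defs.b _)     (Defs.a _)     = no λ ()
line-≟ (Defs.b _)     (Defs.c _ _ _) = no λ ()
line-≟ (Defs.c _ _ _) (Defs.a _)     = no λ ()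
line-≟ (Defs.c _ _ _) (Defs.b _)     = no λ ()

skew? : ∀ l m → Dec (Skew l m)
skew? (Defs.a i)     (Defs.a j)     = ¬? (i Fin.≟ j)
skew? (Defs.a i)     (Defs.b j)     = i Fin.≟ j
skew? (Defs.a i)     (Defs.c j k _) = ¬? (i Fin.≟ j) ×-dec ¬? (i Fin.≟ k)
skew? (Defs.b i)     (Defs.a j)     = i Fin.≟ j
skew? (Defs.b i)     (Defs.b j)     = ¬? (i Fin.≟ j)
skew? (Defs.b i)     (Defs.c j k _) = ¬? (i Fin.≟ j) ×-dec ¬? (i Fin.≟ k)
skew? (Defs.c j k _) (Defs.a i)     = ¬? (i Fin.≟ j) ×-dec ¬? (i Fin.≟ k)
skew? (Defs.c j k _) (Defs.b i)     = ¬? (i Fin.≟ j) ×-dec ¬? (i Fin.≟ k)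
skew? (Defs.c i j _) (Defs.c k l _) = common i j k l ≟ 1

abstract
  lineδ-zero : ∀ l m → lineδ l m ≡ 0 → l ≡ m
  lineδ-zero = toWitness {a? = all-lines? λ l → all-lines? λ m → (lineδ l m ≟ 0) →-dec line-≟ l m} tt

  skew⇒δ : ∀ l m → Skew l m → lineδ l m ≡ 1
  skew⇒δ = toWitness {a? = all-lines? λ l → all-lines? λ m → skew? l m →-dec (lineδ l m ≟ 1)} tt

  δ⇒skew : ∀ l m → lineδ l m ≡ 1 → Skew l m
  δ⇒skew = toWitness {a? = all-lines? λ l → all-lines? λ m → (lineδ l m ≟ 1) →-dec skew? l m} tt

  lineδ-two : ∀ l m → lineδ l m ≡ 2 → ∃[ w ] (lineδ l w ≡ 1 × lineδ w m ≡ 1)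
  lineδ-two = toWitness {a? = all-lines? λ l → all-lines? λ m → (lineδ l m ≟ 2) →-dec
    any-line? λ w → (lineδ l w ≟ 1) ×-dec (lineδ w m ≟ 1)} tt

lineVertex-injective : ∀ {l m} → lineVertex l ≡ lineVertex m → l ≡ m
lineVertex-injective {l} {m} e = lineδ-zero l m
  (trans (cong (λ u → gossetδ (proj₁ (lineVertex l)) (proj₁ u)) (sym e))
    (δ-refl gosset-metric (proj₁ (lineVertex l))))

module SchlafliPullback = Pullback (Local gosset-metric gosset-origin) lineVertex
  (proj₁ ∘ vertexLine) (proj₂ ∘ vertexLine) lineVertex-injective

schlafli-metric : ParMetric Line
schlafli-metric = SchlafliPullback.metric

Local-gosset : Local gosset-metric gosset-origin ≃ schlafli-metric
Local-gosset = ≃-sym SchlafliPullback.equivalence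

schlafli-edge : ∀ l m → E Schlafli l m ⇔ δ schlafli-metric l m ≡ 1
schlafli-edge l m = mk⇔ (skew⇒δ l m) (δ⇒skew l m)

bounded-geodesic : ∀ {A} (M : ParMetric A) → (∀ u v → δ M u v ≤ 2) →
  (∀ u v → δ M u v ≡ 2 → ∃[ w ] (δ M u w ≡ 1 × δ M w v ≡ 1)) → Geodesic M
bounded-geodesic M bound two u v zero          e = v , e , δ-refl M v
bounded-geodesic M bound two u v (suc zero)    e = two u v e
bounded-geodesic M bound two u v (suc (suc n)) e =
  ⊥-elim (m+1+n≰m 2 (≤-trans (≤-reflexive (sym e)) (bound u v)))

schlafli-geodesic : Geodesic schlafli-metric
schlafli-geodesic = bounded-geodesic schlafli-metric
  (λ l m → Local-bounded gosset-metric gosset-origin (lineVertex l) (lineVertex m)) lineδ-two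

schlafli-origin : Line
schlafli-origin = Defs.a zero

all-subsets? : ∀ {n} {P : Subset n → Set} → (∀ s → Dec (P s)) → Dec (∀ s → P s)
all-subsets? {zero}  P? = map′ (λ { p [] → p }) (λ f → f []) (P? [])
all-subsets? {suc n} P? = map′ (λ { (f , g) (false ∷ s) → f s ; (f , g) (true ∷ s) → g s })
  (λ f → (λ s → f (false ∷ s)) , (λ s → f (true ∷ s)))
  (all-subsets? (λ s → P? (false ∷ s)) ×-dec all-subsets? (λ s → P? (true ∷ s)))

-- Meaningful only on the lines skew to schlafli-origin.
lineWord : Line → Subset 5
lineWord (Defs.a zero)                = Subset.⊥
lineWord (Defs.a (suc i))             = ∁ ⁅ i ⁆
lineWord (Defs.b _)                   = Subset.⊥
lineWord (Defs.c zero _ _)            = Subset.⊥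
lineWord (Defs.c (suc i) zero _)      = Subset.⊥
lineWord (Defs.c (suc i) (suc j) _)   = ⁅ i ⁆ ∪ ⁅ j ⁆

abstract
  lineWord-even : ∀ l → ∣ lineWord l ∣ % 2 ≡ 0
  lineWord-even = toWitness {a? = all-lines? λ l → ∣ lineWord l ∣ % 2 ≟ 0} tt

  lineWord-isom : ∀ l → lineδ schlafli-origin l ≡ 1 → ∀ m → lineδ schlafli-origin m ≡ 1 →
                  ⌊ hdist (lineWord l) (lineWord m) /2⌋ ≡ lineδ l m
  lineWord-isom = toWitness {a? = all-lines? λ l → (lineδ schlafli-origin l ≟ 1) →-dec
    all-lines? λ m → (lineδ schlafli-origin m ≟ 1) →-dec
    (⌊ hdist (lineWord l) (lineWord m) /2⌋ ≟ lineδ l m)} tt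

  lineWord-onto : ∀ s → ∣ s ∣ % 2 ≡ 0 → ∃[ l ] (lineδ schlafli-origin l ≡ 1 × lineWord l ≡ s)
  lineWord-onto = toWitness {a? = all-subsets? λ s → (∣ s ∣ % 2 ≟ 0) →-dec
    any-line? λ l → (lineδ schlafli-origin l ≟ 1) ×-dec Vec.≡-dec Bool._≟_ (lineWord l) s} tt

-- Sixteen lines are skew to the origin: one `b`, five `a` and ten `c`. They match the empty set,
-- the five sets of four points and the ten pairs among five points.
Local-schlafli : Local schlafli-metric schlafli-origin ≃ halved-metric 5
Local-schlafli = record
  { to      = λ { (l , _) → lineWord l , lineWord-even l }
  ; from    = λ { (s , p) → let l , e , _ = lineWord-onto s p in l , e }
  ; isom    = λ { (l , e) (m , f) → lineWord-isom l e m f }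
  ; to-from = λ { (s , p) → Σ-≡ ≡-irrelevant (proj₂ (proj₂ (lineWord-onto s p))) }
  }

-- Finite covers

-- The bound `n` is the induction measure. It need not be the exact size, so a subset is covered by
-- filtering, and losing one element lowers the bound.
record Cover (A : Set) (n : ℕ) : Set where
  field
    list   : List A
    bound  : length list ≤ n
    member : ∀ u → u ∈ list
open Cover

module _ {A : Set} {P : A → Set} (irr : ∀ {u} (p q : P u) → p ≡ q) (P? : ∀ u → Dec (P u)) where
  filterΣ : List A → List (Σ A P)
  filterΣ []       = []
  filterΣ (u ∷ us) with P? u
  ... | yes p = (u , p) ∷ filterΣ us
  ... | no  _ = filterΣ us

  ∈-filterΣ : ∀ {u} us (p : P u) → u ∈ us → (u , p) ∈ filterΣ us
  ∈-filterΣ (u ∷ us) p (here refl) with P? u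
  ... | yes q = here (cong (u ,_) (irr p q))
  ... | no ¬p = ⊥-elim (¬p p)
  ∈-filterΣ (w ∷ us) p (there m) with P? w
  ... | yes _ = there (∈-filterΣ us p m)
  ... | no  _ = ∈-filterΣ us p m

  length-filterΣ : ∀ us → length (filterΣ us) ≤ length us
  length-filterΣ []       = z≤n
  length-filterΣ (u ∷ us) with P? u
  ... | yes _ = s≤s (length-filterΣ us)
  ... | no  _ = m≤n⇒m≤1+n (length-filterΣ us)

  length-filterΣ-< : ∀ {u} us → u ∈ us → ¬ P u → length (filterΣ us) < length us
  length-filterΣ-< (u ∷ us) (here refl) ¬p with P? u
  ... | yes p = ⊥-elim (¬p p)
  ... | no  _ = s≤s (length-filterΣ us)
  length-filterΣ-< (w ∷ us) (there m) ¬p with P? w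
  ... | yes _ = s≤s (length-filterΣ-< us m ¬p)
  ... | no  _ = m≤n⇒m≤1+n (length-filterΣ-< us m ¬p)

  subcover : ∀ {n} → Cover A n → Cover (Σ A P) n
  subcover c = record
    { list   = filterΣ (list c)
    ; bound  = ≤-trans (length-filterΣ (list c)) (bound c)
    ; member = λ { (u , p) → ∈-filterΣ (list c) p (member c u) }
    }

  subcover-< : ∀ {n u} → Cover A (suc n) → ¬ P u → Cover (Σ A P) n
  subcover-< {u = u} c ¬p = record
    { list   = filterΣ (list c)
    ; bound  = ≤-pred (≤-trans (length-filterΣ-< (list c) (member c u) ¬p) (bound c))
    ; member = λ { (u , p) → ∈-filterΣ (list c) p (member c u) }
    }

Local-cover : ∀ {A n} (M : ParMetric A) (o : A) → Cover A (suc n) →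
              Cover (Σ A (λ u → δ M o u ≡ 1)) n
Local-cover M o c = subcover-< ≡-irrelevant (λ u → δ M o u ≟ 1) {u = o} c
  (λ e → 0≢1+n (trans (sym (δ-refl M o)) e))

Bounded : ∀ {A} → ParMetric A → Set
Bounded M = ∀ u v → δ M u v ≤ 2

-- Components of a bounded metric

module Component {A : Set} (M : ParMetric A) (bounded : Bounded M) where
  -- A walk of length at most two. By `linked-step` this is already the relation of lying in the
  -- same component.
  Linked : A → A → Set
  Linked u v = δ M u v ≤ 1 ⊎ ∃[ w ] (δ M u w ≡ 1 × δ M w v ≡ 1)

  linked-sym : ∀ {u v} → Linked u v → Linked v u
  linked-sym {u} {v} (inj₁ l) = inj₁ (subst (_≤ 1) (δ-sym M u v) l)
  linked-sym {u} {v} (inj₂ (w , e , f)) = inj₂ (w , trans (δ-sym M v w) f , trans (δ-sym M w u) e)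

  data Value (u v : A) : Set where
    equal    : u ≡ v → Value u v
    adjacent : δ M u v ≡ 1 → Value u v
    distant  : δ M u v ≡ 2 → Value u v

  value : ∀ u v → Value u v
  value u v with δ M u v in e | bounded u v
  ... | 0 | _ = equal (δ-zero M e)
  ... | 1 | _ = adjacent e
  ... | 2 | _ = distant e
  ... | suc (suc (suc _)) | s≤s (s≤s ())

  adjacent⇒linked : ∀ {u v} → δ M u v ≡ 1 → Linked u v
  adjacent⇒linked e = inj₁ (≤-reflexive e)

  distant⇒¬near : ∀ {u v} → δ M u v ≡ 2 → ¬ δ M u v ≤ 1
  distant⇒¬near e l = 1+n≰n (subst (_≤ 1) e l)

  -- A path o, w, v, u of length three is shortened by w − v + u.
  linked-step : ∀ {o v u} → Linked o v → δ M v u ≡ 1 → Linked o u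
  linked-step {o} {v} {u} l e with value o u | value o v | l
  ... | equal refl  | _            | _ = inj₁ (subst (_≤ 1) (sym (δ-refl M o)) z≤n)
  ... | adjacent ou | _            | _ = adjacent⇒linked ou
  ... | distant _   | equal refl   | _ = adjacent⇒linked e
  ... | distant _   | adjacent ov  | _ = inj₂ (v , ov , e)
  ... | distant _   | distant ov   | inj₁ m = ⊥-elim (distant⇒¬near ov m)
  ... | distant ou  | distant ov   | inj₂ (w , ow , wv) with value w u
  ...   | equal refl  = adjacent⇒linked ow
  ...   | adjacent wu = inj₂ (w , ow , wu)
  ...   | distant wu  = inj₂ (w' , ow' , w'u)
    where
    fourth = para M {v} {u} {w} e (trans wu (cong suc (sym wv)))
    w' = proj₁ fourth
    w'o : δ M w' o ≡ 1
    w'o = +-cancelʳ-≡ (δ M v o) (δ M w' o) 1 (trans (proj₂ fourth o)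
      (cong₂ _+_ (trans (δ-sym M w o) ow) (trans (δ-sym M u o) (trans ou
        (trans (sym ov) (δ-sym M o v))))))
    ow' : δ M o w' ≡ 1
    ow' = trans (δ-sym M o w') w'o
    w'u : δ M w' u ≡ 1
    w'u = +-cancelʳ-≡ (δ M v u) (δ M w' u) 1 (trans (proj₂ fourth u)
      (trans (cong₂ _+_ wu (δ-refl M u)) (cong suc (sym e))))

  linked-trans : ∀ {u o v} → Linked u o → Linked o v → Linked u v
  linked-trans {u} {o} {v} l (inj₁ m) with value o v
  ... | equal refl  = l
  ... | adjacent ov = linked-step l ov
  ... | distant ov  = ⊥-elim (distant⇒¬near ov m)
  linked-trans l (inj₂ (w , e , f)) = linked-step (linked-step l e) f

  module Split {n} (cover : Cover A n) (o : A) where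
    linked? : ∀ v → Dec (Linked o v)
    linked? v = (δ M o v ≤? 1) ⊎-dec
      map′ (λ p → let w , _ , q = find p in w , q) (λ { (w , q) → lose (member cover w) q })
        (any? (λ w → (δ M o w ≟ 1) ×-dec (δ M w v ≟ 1)) (list cover))

    -- Phrased by the Boolean outcome so that proofs are unique, as `restrict` demands; `Linked` can
    -- hold through several middle vertices.
    In Out : A → Set
    In  v = does (linked? v) ≡ true
    Out v = does (linked? v) ≡ false

    in⇒linked : ∀ {v} → In v → Linked o v
    in⇒linked {v} = does-true (linked? v)
      where
      does-true : ∀ {P : Set} (d : Dec P) → does d ≡ true → P
      does-true (yes p) _ = p

    linked⇒in : ∀ {v} → Linked o v → In v
    linked⇒in {v} = dec-true (linked? v)

    out⇒¬linked : ∀ {v} → Out v → ¬ Linked o v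
    out⇒¬linked {v} p l with () ← trans (sym p) (linked⇒in l)

    component : ParMetric (Σ A In)
    component = restrict M In uip λ {_} {_} {u} {u'} _ _ p _ _ e →
      linked⇒in (linked-step (in⇒linked p) (trans (δ-sym M u u') e))

    others : ParMetric (Σ A Out)
    others = restrict M Out uip λ {_} {_} {u} {u'} _ _ p _ _ e →
      dec-false (linked? u') (λ l → out⇒¬linked p (linked-step l e))

    component-geodesic : Geodesic component
    component-geodesic = bounded-geodesic component (λ s t → bounded (proj₁ s) (proj₁ t)) two
      where
      two : ∀ s t → δ component s t ≡ 2 → ∃[ w ] (δ component s w ≡ 1 × δ component w t ≡ 1)
      two (u , p) (v , q) e with linked-trans (linked-sym (in⇒linked p)) (in⇒linked q)
      ... | inj₁ l = ⊥-elim (distant⇒¬near e l)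
      ... | inj₂ (w , f , g) = (w , linked⇒in (linked-step (in⇒linked p) f)) , f , g

    split : M ≃ component ⊕ others
    split = ≃-sym (record { to = into ; from = out ; isom = isom-into ; to-from = into-out })
      where
      into : Σ A In ⊎ Σ A Out → A
      into (inj₁ (u , _)) = u
      into (inj₂ (u , _)) = u
      side : ∀ v → In v ⊎ Out v
      side v with does (linked? v)
      ... | true  = inj₁ refl
      ... | false = inj₂ refl
      out : A → Σ A In ⊎ Σ A Out
      out v = [ (λ p → inj₁ (v , p)) , (λ p → inj₂ (v , p)) ]′ (side v)
      into-out : ∀ v → into (out v) ≡ v
      into-out v with side v
      ... | inj₁ _ = refl
      ... | inj₂ _ = refl
      apart : ∀ {u v} → In u → Out v → δ M u v ≡ 2
      apart {u} {v} p q with value u v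
      ... | equal refl = ⊥-elim (out⇒¬linked q (in⇒linked p))
      ... | adjacent e = ⊥-elim (out⇒¬linked q (linked-step (in⇒linked p) e))
      ... | distant e  = e
      isom-into : ∀ s t → δ M (into s) (into t) ≡ δ (component ⊕ others) s t
      isom-into (inj₁ _)       (inj₁ _)       = refl
      isom-into (inj₂ _)       (inj₂ _)       = refl
      isom-into (inj₁ (u , p)) (inj₂ (v , q)) = apart p q
      isom-into (inj₂ (u , p)) (inj₁ (v , q)) = trans (δ-sym M u v) (apart q p)

    others-cover : ∀ {m} → Cover A (suc m) → Cover (Σ A Out) m
    others-cover c = subcover-< uip (λ v → does (linked? v) Bool.≟ false) {u = o} c
      (λ p → out⇒¬linked p (inj₁ (subst (_≤ 1) (sym (δ-refl M o)) z≤n)))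

    component-cover : ∀ {m} → Cover A m → Cover (Σ A In) m
    component-cover = subcover uip (λ v → does (linked? v) Bool.≟ true)

-- Connected local graphs and the graphs they determine

-- The offsets in `Point` start each family late: `grid m n` has sides `m + 1` and `n + 1`, so
-- complete graphs are `grid m 0`; CP(2) is the first connected CP with an edge; J(n,2) starts at
-- `n = 5`, since J(4,2) is CP(3) and J(3,2) is complete.
data Kind : Set where
  grid       : (m n : ℕ) → Kind
  cocktail   : (k : ℕ) → Kind
  triangular : (n : ℕ) → Kind
  halved₅    : Kind
  schläfli   : Kind

Point : Kind → Set
Point (grid m n)     = V (Johnson (suc m) 1) × V (Johnson (suc n) 1)
Point (cocktail k)   = V (CocktailParty (2 + k))
Point (triangular n) = V (Johnson (5 + n) 2)
Point halved₅        = V (HalvedCube 5)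
Point schläfli       = Line

kindMetric : ∀ t → ParMetric (Point t)
kindMetric (grid m n)     = johnson-metric (suc m) 1 ⊗ johnson-metric (suc n) 1
kindMetric (cocktail k)   = cocktail-metric (2 + k)
kindMetric (triangular n) = johnson-metric (5 + n) 2
kindMetric halved₅        = halved-metric 5
kindMetric schläfli       = schlafli-metric

lift : Kind → Factor
lift (grid m n)     = johnson (suc m + suc n) (suc m)
lift (cocktail k)   = cocktailParty (3 + k)
lift (triangular n) = halvedCube (5 + n)
lift halved₅        = schlafli
lift schläfli       = gosset

liftMetric : ∀ t → ParMetric (V ⟦ lift t ⟧)
liftMetric (grid m n)     = johnson-metric (suc m + suc n) (suc m)
liftMetric (cocktail k)   = cocktail-metric (3 + k)
liftMetric (triangular n) = halved-metric (5 + n)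
liftMetric halved₅        = schlafli-metric
liftMetric schläfli       = gosset-metric

lift-edge : ∀ t u v → E ⟦ lift t ⟧ u v ⇔ δ (liftMetric t) u v ≡ 1
lift-edge (grid m n)     = johnson-edge
lift-edge (cocktail k)   = cocktail-edge (3 + k)
lift-edge (triangular n) = halved-edge
lift-edge halved₅        = schlafli-edge
lift-edge schläfli       = gosset-edge

lift-geodesic : ∀ t → Geodesic (liftMetric t)
lift-geodesic (grid m n)     = johnson-geodesic (suc m + suc n) (suc m)
lift-geodesic (cocktail k)   = cocktail-geodesic (suc k)
lift-geodesic (triangular n) = halved-geodesic (5 + n)
lift-geodesic halved₅        = schlafli-geodesic
lift-geodesic schläfli       = gosset-geodesic

lift-origin : ∀ t → V ⟦ lift t ⟧
lift-origin (grid m n)     = johnson-origin (suc m) (suc n)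
lift-origin (cocktail k)   = zero , false
lift-origin (triangular n) = halved-origin (5 + n)
lift-origin halved₅        = schlafli-origin
lift-origin schläfli       = gosset-origin

Local-lift : ∀ t → Local (liftMetric t) (lift-origin t) ≃ kindMetric t
Local-lift (grid m n)     = Local-johnson (suc m) (suc n)
Local-lift (cocktail k)   = Local-cocktail (2 + k)
Local-lift (triangular n) = Local-halved (5 + n)
Local-lift halved₅        = Local-schlafli
Local-lift schläfli       = Local-gosset

-- Carries coincidences of local graphs over to the larger graphs: transposing a grid gives the
-- symmetry of Johnson graphs, and `square` gives J(4,2) as CP(3).
lift-cong : ∀ t t' → kindMetric t ≃ kindMetric t' → liftMetric t ≃ liftMetric t'
lift-cong t t' e = local-determines (lift-geodesic t) (lift-geodesic t')
  (≃-trans (Local-lift t) (≃-trans e (≃-sym (Local-lift t'))))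

-- The final factor is the one-vertex graph.
factors : List Kind → List⁺ Factor
factors []       = hamming 0 0 ∷ []
factors (t ∷ ts) = lift t ∷⁺ factors ts

Product : List Kind → Graph
Product ts = ⨂ (map ⟦_⟧ (factors ts))

productMetric : ∀ ts → ParMetric (V (Product ts))
productMetric []       = point
productMetric (t ∷ ts) = liftMetric t ⊗ productMetric ts

product-edge : ∀ ts u v → E (Product ts) u v ⇔ δ (productMetric ts) u v ≡ 1
product-edge []       u v = mk⇔ (λ ()) (λ ())
product-edge (t ∷ ts) (u , u') (v , v') = mk⇔ forth back
  where
  forth : E (Product (t ∷ ts)) (u , u') (v , v') → δ (productMetric (t ∷ ts)) (u , u') (v , v') ≡ 1
  forth (inj₁ (e , refl)) = cong₂ _+_ (Equivalence.to (lift-edge t u v) e) (δ-refl (productMetric ts) u')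
  forth (inj₂ (refl , e)) = cong₂ _+_ (δ-refl (liftMetric t) u) (Equivalence.to (product-edge ts u' v') e)
  back : δ (productMetric (t ∷ ts)) (u , u') (v , v') ≡ 1 → E (Product (t ∷ ts)) (u , u') (v , v')
  back e with δ (liftMetric t) u v in eq
  ... | 0 = inj₂ (δ-zero (liftMetric t) eq , Equivalence.from (product-edge ts u' v') e)
  ... | 1 = inj₁ (Equivalence.from (lift-edge t u v) eq , δ-zero (productMetric ts) (suc-injective e))

product-geodesic : ∀ ts → Geodesic (productMetric ts)
product-geodesic []       _ _ _ ()
product-geodesic (t ∷ ts) = ⊗-geodesic {M = liftMetric t} {productMetric ts} (lift-geodesic t) (product-geodesic ts)

product-origin : ∀ ts → V (Product ts)
product-origin []       = tt
product-origin (t ∷ ts) = lift-origin t , product-origin ts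

SumPoint : List Kind → Set
SumPoint []       = ⊥
SumPoint (t ∷ ts) = Point t ⊎ SumPoint ts

sumMetric : ∀ ts → ParMetric (SumPoint ts)
sumMetric []       = empty
sumMetric (t ∷ ts) = kindMetric t ⊕ sumMetric ts

Local-product : ∀ ts → Local (productMetric ts) (product-origin ts) ≃ sumMetric ts
Local-product []       = empty-≃ λ { (_ , ()) }
Local-product (t ∷ ts) = ≃-trans (Local-⊗ (lift-origin t) (product-origin ts))
  (⊕-cong (Local-lift t) (Local-product ts))

recognise : ∀ {A} {M : ParMetric A} {o} ts → Geodesic M → Local M o ≃ sumMetric ts → M ≃ productMetric ts
recognise ts geo e = local-determines geo (product-geodesic ts) (≃-trans e (≃-sym (Local-product ts)))

-- Products of diameter at most two

Spread : ∀ {A} → ℕ → ParMetric A → Set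
Spread m M = ∃[ u ] ∃[ v ] m ≤ δ M u v

spread-⊗ : ∀ {A B m n} {M : ParMetric A} {N : ParMetric B} → Spread m M → Spread n N → Spread (m + n) (M ⊗ N)
spread-⊗ (u , v , l) (u' , v' , l') = (u , u') , (v , v') , +-mono-≤ l l'

spread-≃ : ∀ {A B m} {M : ParMetric A} {N : ParMetric B} → M ≃ N → Spread m N → Spread m M
spread-≃ {m = m} e (u , v , l) = from e u , from e v , subst (m ≤_) (sym (from-isom e u v)) l

spread-bounded : ∀ {A} {X : Set} (M : ParMetric A) → Bounded M → Spread 3 M → X
spread-bounded M bounded (u , v , l) = ⊥-elim (1+n≰n (≤-trans l (bounded u v)))

spread-complete : ∀ n → Spread 1 (johnson-metric (2 + n) 1)
spread-complete n = (true ∷ false ∷ Subset.⊥ , cong suc (∣⊥∣≡0 n)) , (false ∷ true ∷ Subset.⊥ , cong suc (∣⊥∣≡0 n)) ,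
  ≤-reflexive (sym (cong (λ m → ⌊ 2 + m /2⌋) (hdist-refl (Subset.⊥ {n}))))

spread-kind : ∀ {m} t → Spread m (kindMetric t) → Spread m (liftMetric t)
spread-kind {m} t s = let (u , _) , (v , _) , l = spread-≃ (Local-lift t) s in u , v , l

spread-johnson : ∀ m n → Spread 3 (johnson-metric (3 + m + (3 + n)) (3 + m))
spread-johnson m n =
  (true ∷ true ∷ true ∷ (Subset.⊤ {m} ++ false ∷ false ∷ false ∷ Subset.⊥ {n}) ,
     cong (3 +_) (trans (∣++∣ (Subset.⊤ {m}) _) (trans (cong₂ _+_ (∣⊤∣≡n m) (∣⊥∣≡0 n)) (+-identityʳ m)))) ,
  (false ∷ false ∷ false ∷ (Subset.⊤ {m} ++ true ∷ true ∷ true ∷ Subset.⊥ {n}) ,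
     trans (∣++∣ (Subset.⊤ {m}) _) (trans (cong₂ _+_ (∣⊤∣≡n m) (cong (3 +_) (∣⊥∣≡0 n))) (+-comm m 3))) ,
  ≤-reflexive (sym (cong (λ k → ⌊ 3 + k /2⌋) (trans (hdist-++ (Subset.⊤ {m}) Subset.⊤ _ _)
    (cong₂ _+_ (hdist-refl (Subset.⊤ {m})) (cong (3 +_) (hdist-refl (Subset.⊥ {n})))))))

spread-halved : ∀ n → Spread 3 (halved-metric (6 + n))
spread-halved n = halved-origin (6 + n) ,
  (true ∷ true ∷ true ∷ true ∷ true ∷ true ∷ Subset.⊥ , ∣⊥∣%2 n) ,
  ≤-reflexive (sym (cong (λ k → ⌊ 6 + k /2⌋) (hdist-refl (Subset.⊥ {n}))))

⊗-point : ∀ {A} {M : ParMetric A} → M ⊗ point ≃ M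
⊗-point {M = M} = record
  { to = proj₁ ; from = _, tt ; isom = λ _ _ → sym (+-identityʳ _) ; to-from = λ _ → refl }

johnson-1-1 : johnson-metric 1 1 ≃ point
johnson-1-1 = record
  { to      = λ _ → tt
  ; from    = λ _ → true ∷ [] , refl
  ; isom    = λ { (true ∷ [] , _) (true ∷ [] , _) → refl }
  ; to-from = λ _ → refl
  }

complete⇒grid : ∀ n → johnson-metric (suc n) 1 ≃ kindMetric (grid n 0)
complete⇒grid n = ≃-sym (≃-trans (⊗-cong ≃-refl johnson-1-1) ⊗-point)

grid-comm : ∀ m n → liftMetric (grid m n) ≃ liftMetric (grid n m)
grid-comm m n = lift-cong (grid m n) (grid n m) ⊗-comm

-- Each lift of diameter at most two is itself a kind: complete graphs, J(4,2) as CP(3), J(n,2),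
-- CP(k), the halved 5-cube and the Schläfli graph. The other Johnson graphs, the larger halved
-- cubes and the Gosset graph have vertices at distance three.
single : ∀ t → Bounded (liftMetric t) → ∃[ t' ] liftMetric t ≃ kindMetric t'
single (grid 0 n)                         _ = grid (suc n) 0 , complete⇒grid (suc n)
single (grid (suc m) 0)                   _ = grid (suc (suc m)) 0 ,
  ≃-trans (grid-comm (suc m) 0) (complete⇒grid (suc (suc m)))
single (grid 1 1)                         _ = cocktail 1 , lift-cong (grid 1 1) (cocktail 0) square
single (grid 1 (suc (suc n)))             _ = triangular n , ≃-refl
single (grid (suc (suc m)) 1)             _ = triangular m , grid-comm (suc (suc m)) 1
single (grid (suc (suc m)) (suc (suc n))) b =
  spread-bounded (liftMetric (grid (2 + m) (2 + n))) b (spread-johnson m n)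
single (cocktail k)                       _ = cocktail (suc k) , ≃-refl
single (triangular 0)                     _ = halved₅ , ≃-refl
single (triangular (suc n))               b =
  spread-bounded (halved-metric (6 + n)) b (spread-halved n)
single halved₅                            _ = schläfli , ≃-refl
single schläfli                           b = spread-bounded gosset-metric b
  ((proj₁ gosset-origin , false) , (proj₁ gosset-origin , true) , ≤-refl)

complete-or-spread : ∀ t → (∃[ n ] liftMetric t ≃ johnson-metric (2 + n) 1) ⊎ Spread 2 (liftMetric t)
complete-or-spread (grid 0 n)             = inj₁ (n , ≃-refl)
complete-or-spread (grid (suc m) 0)       = inj₁ (suc m , grid-comm (suc m) 0)
complete-or-spread (grid (suc m) (suc n)) = inj₂ (spread-kind (grid (suc m) (suc n))
  (spread-⊗ {M = johnson-metric (2 + m) 1} {johnson-metric (2 + n) 1} (spread-complete m) (spread-complete n)))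
complete-or-spread (cocktail k)           = inj₂ ((zero , false) , (zero , true) , ≤-refl)
complete-or-spread (triangular n)         = inj₂ (halved-origin (5 + n) ,
  (true ∷ true ∷ true ∷ true ∷ false ∷ Subset.⊥ , ∣⊥∣%2 n) ,
  ≤-reflexive (sym (cong (λ k → ⌊ 4 + k /2⌋) (hdist-refl (Subset.⊥ {n})))))
complete-or-spread halved₅                = inj₂ (Defs.a zero , Defs.b (suc zero) , ≤-refl)
complete-or-spread schläfli               = inj₂ ((proj₁ gosset-origin , false) , (proj₁ gosset-origin , true) , s≤s (s≤s z≤n))

spread-lift : ∀ t → Spread 1 (liftMetric t)
spread-lift t with complete-or-spread t
... | inj₁ (n , e)     = spread-≃ e (spread-complete n)
... | inj₂ (u , v , l) = u , v , ≤-trans (s≤s z≤n) l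

bounded-≃ : ∀ {A B} {M : ParMetric A} {N : ParMetric B} → M ≃ N → Bounded M → Bounded N
bounded-≃ e bounded u v = subst (_≤ 2) (from-isom e u v) (bounded (from e u) (from e v))

-- Diameters add, and every lift has an edge. Three factors therefore exceed two, and two factors
-- must both be complete and form a grid. The empty product is the grid with one vertex.
bounded-product : ∀ ts → Bounded (productMetric ts) → ∃[ t ] productMetric ts ≃ kindMetric t
bounded-product [] _ = grid 0 0 , ≃-trans (≃-sym johnson-1-1) (complete⇒grid 0)
bounded-product (t ∷ []) b =
  let t' , e = single t (bounded-≃ (⊗-point {M = liftMetric t}) b) in t' , ≃-trans ⊗-point e
bounded-product (t ∷ t' ∷ []) b with complete-or-spread t | complete-or-spread t'
... | inj₁ (m , e) | inj₁ (n , f) = grid (suc m) (suc n) , ⊗-cong e (≃-trans ⊗-point f)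
... | inj₂ s       | _            = spread-bounded (productMetric (t ∷ t' ∷ [])) b
  (spread-⊗ {M = liftMetric t} {productMetric (t' ∷ [])} s
    (spread-≃ (⊗-point {M = liftMetric t'}) (spread-lift t')))
... | inj₁ _       | inj₂ s       = spread-bounded (productMetric (t ∷ t' ∷ [])) b
  (spread-⊗ {M = liftMetric t} {productMetric (t' ∷ [])} (spread-lift t)
    (spread-≃ (⊗-point {M = liftMetric t'}) s))
bounded-product (t ∷ t' ∷ t″ ∷ ts) b = spread-bounded (productMetric (t ∷ t' ∷ t″ ∷ ts)) b
  (spread-⊗ {M = liftMetric t} {productMetric (t' ∷ t″ ∷ ts)} (spread-lift t)
    (spread-⊗ {M = liftMetric t'} {productMetric (t″ ∷ ts)} (spread-lift t')
      (spread-⊗ {n = 0} {M = liftMetric t″} {productMetric ts} (spread-lift t″)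
        (product-origin ts , product-origin ts , z≤n))))

-- The induction on the number of vertices

decompose : ∀ n {A} (M : ParMetric A) → Bounded M → Cover A n → ∃[ ts ] M ≃ sumMetric ts
-- A component can be all of `M`, so the bound stays the same from `decompose` to `classify`. It
-- falls from `classify` to the local metric, which omits `o`, and from `decompose` to the other
-- components.
classify  : ∀ n {A} (M : ParMetric A) → Bounded M → Geodesic M → A → Cover A n → ∃[ t ] M ≃ kindMetric t

decompose n M bounded cover with list cover in eq
decompose n M bounded cover | [] = [] , empty-≃ λ u → absurd (subst (u ∈_) eq (member cover u))
  where
  absurd : ∀ {u} → u ∈ [] → ⊥
  absurd ()
decompose zero M bounded cover | _ ∷ _ with () ← subst (λ us → length us ≤ 0) eq (bound cover)
decompose (suc n) M bounded cover | o ∷ _ =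
  let t  , e = classify (suc n) component (λ s t → bounded (proj₁ s) (proj₁ t)) component-geodesic
                 (o , linked⇒in (inj₁ (subst (_≤ 1) (sym (δ-refl M o)) z≤n))) (component-cover cover)
      ts , f = decompose n others (λ s t → bounded (proj₁ s) (proj₁ t)) (others-cover cover)
  in t ∷ ts , ≃-trans split (⊕-cong e f)
  where
  open Component M bounded
  open Split cover o

classify zero M bounded geo o cover with list cover | bound cover | member cover o
... | [] | _ | ()
classify (suc n) M bounded geo o cover =
  let ts , e = decompose n (Local M o) (Local-bounded M o) (Local-cover M o cover)
      f      = recognise ts geo e
      t  , g = bounded-product ts (bounded-≃ f bounded)
  in t , ≃-trans f g

theorem2p16 : (G : Graph) → IsSimple G → IsFinite G → Connected G → Reflective G →
    ∃[ fs ] (G ≅ ⨂ (map ⟦_⟧ fs))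
theorem2p16 G simple finite connected reflective = factors ts , record
  { bij  = mk↔ₛ′ (to iso) (from iso) (to-from iso) (from-to iso)
  ; pres = λ u v → mk⇔
      (λ e → Equivalence.from (product-edge ts _ _) (trans (isom iso u v) (d-edge e)))
      (λ e → edge-d (trans (sym (isom iso u v)) (Equivalence.to (product-edge ts _ _) e)))
  }
  where
  open GraphDistance G simple finite connected
  open ReflectiveDistance G simple finite connected reflective
  open IsFinite finite
  -- `Local-cover` expects a successor and returns its predecessor, hence the bound one above the
  -- number of vertices.
  vertices : Cover (V G) (suc size)
  vertices = record
    { list   = List.map (Inverse.from enum) (allFin size)
    ; bound  = m≤n⇒m≤1+n (≤-reflexive (trans (length-map (Inverse.from enum) (allFin size)) (length-tabulate id)))
    ; member = λ u → subst (_∈ List.map (Inverse.from enum) (allFin size)) (Inverse.strictlyInverseʳ enum u)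
                 (∈-map⁺ (Inverse.from enum) (∈-allFin (Inverse.to enum u)))
    }
  o = proj₁ connected
  local = decompose size (Local graphMetric o) (Local-bounded graphMetric o) (Local-cover graphMetric o vertices)
  ts = proj₁ local
  iso : graphMetric ≃ productMetric ts
  iso = recognise ts graphMetric-geodesic (proj₂ local)
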